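{- Let $G$ be an $r$-regular graph with $n$ vertices and $m$ edges, and let $q_1\le q_2\le\dots\le q_n$ be the signless Laplacian eigenvalues of $G$ (so $q_n=2r$). Then \[ f(\lambda,G^{0-1})=[(\lambda-m)(\lambda-2m-n+4r-2)-mn](\lambda-m-n+2r-2)^{m-n}(\lambda-m)^{n-1}\prod_{i=1}^{n-1}(\lambda-m-n-2+2r+q_i). \]
   Context: All graphs are finite and simple. For a graph $H$, $Q(H)=D(H)+A(H)$ is its signless Laplacian matrix ($D(H)$ the diagonal degree matrix, $A(H)$ the adjacency matrix), and $f(\lambda,H)=\det(\lambda I-Q(H))$ is its signless Laplacian characteristic polynomial. The signless Laplacian eigenvalues of $G$ are the eigenvalues of $Q(G)$ listed with multiplicity in non-decreasing order; since $G$ is $r$-regular the largest is $2r$, and $2m=rn$. For a graph $H$: $H^0$ is the edgeless graph on $V(H)$, $H^1$ the complete graph on $V(H)$, $H^+=H$, and $H^-$ the complement of $H$. The line graph $G^l$ has vertex set $E(G)$, two vertices adjacent iff the corresponding edges of $G$ share an endpoint. For $x,y,z\in\{0,1,+,-\}$, the $xyz$-transformation $G^{xyz}$ is the graph with vertex set $V(G)\cup E(G)$ (disjoint) and edge set $E(G^x)\cup E((G^l)^y)\cup E(W)$, where $W$ has vertex set $V(G)\cup E(G)$ and its edges are: all pairs $ve$ ($v\in V(G)$, $e\in E(G)$) with $v$ incident to $e$ if $z=+$; all pairs $ve$ with $v$ not incident to $e$ if $z=-$; no edges if $z=0$; all pairs $ve$ with $v\in V(G)$, $e\in E(G)$ if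 $z=1$. -}

module Defs where

open import Data.Nat as ℕ using (ℕ; zero; suc)
open import Data.Integer as ℤ using (ℤ; +_; _-_; _*_; _+_)
open import Data.Fin as Fin using (Fin; zero; suc; toℕ; punchIn; splitAt)
open import Data.Fin.Properties using (_≟_)
open import Data.Bool using (Bool; true; false; _∧_; _∨_; not; if_then_else_)
open import Data.Product using (_×_; _,_; proj₁; proj₂)
open import Data.Sum using (inj₁; inj₂)
open import Relation.Nullary.Decidable using (⌊_⌋)
open import Relation.Binary.PropositionalEquality using (_≡_)

sumFin : ∀ {k} → (Fin k → ℤ) → ℤ
sumFin {zero}  f = + 0
sumFin {suc k} f = f zero + sumFin (λ i → f (suc i))

countFin : ∀ {k} → (Fin k → Bool) → ℕ
countFin {zero}  p = 0
countFin {suc k} p = (if p zero then 1 else 0) ℕ.+ countFin (λ i → p (suc i))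

anyFin : ∀ {k} → (Fin k → Bool) → Bool
anyFin {zero}  p = false
anyFin {suc k} p = p zero ∨ anyFin (λ i → p (suc i))

Matrix : ℕ → Set
Matrix k = Fin k → Fin k → ℤ

det : ∀ {k} → Matrix k → ℤ
det {zero}  M = + 1
det {suc k} M =
  sumFin (λ j → ((ℤ.- + 1) ℤ.^ toℕ j) * M zero j * det (λ a b → M (suc a) (punchIn j b)))

-- Graphs given by a Bool adjacency relation on Fin k (symmetric,
-- irreflexive); signless Laplacian Q = D + A and its characteristic
-- polynomial f(x) = det(xI - Q), evaluated at an integer x.

eqᵇ : ∀ {k} → Fin k → Fin k → Bool
eqᵇ i j = ⌊ i ≟ j ⌋

deg : ∀ {k} → (Fin k → Fin k → Bool) → Fin k → ℕ
deg adj i = countFin (adj i)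

signlessLaplacian : ∀ {k} → (Fin k → Fin k → Bool) → Matrix k
signlessLaplacian adj i j =
  if eqᵇ i j then + deg adj i else (if adj i j then + 1 else + 0)

charPolyAt : ∀ {k} → Matrix k → ℤ → Matrix k
charPolyAt Q x i j = (if eqᵇ i j then x else + 0) - Q i j

signlessCharPoly : ∀ {k} → (Fin k → Fin k → Bool) → ℤ → ℤ
signlessCharPoly adj x = det (charPolyAt (signlessLaplacian adj) x)

record SimpleGraph (n m : ℕ) : Set where
  field
    ends    : Fin m → Fin n × Fin n
    ordered : ∀ e → proj₁ (ends e) Fin.< proj₂ (ends e)
    inj     : ∀ e f → ends e ≡ ends f → e ≡ f
open SimpleGraph public

module _ {n m : ℕ} (G : SimpleGraph n m) where

  incident : Fin n → Fin m → Bool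
  incident v e = eqᵇ v (proj₁ (ends G e)) ∨ eqᵇ v (proj₂ (ends G e))

  adjG : Fin n → Fin n → Bool
  adjG v w = anyFin (λ e → incident v e ∧ incident w e ∧ not (eqᵇ v w))

  degreeG : Fin n → ℕ
  degreeG v = countFin (incident v)

  IsRegular : ℕ → Set
  IsRegular r = ∀ v → degreeG v ≡ r

  adjLine : Fin m → Fin m → Bool
  adjLine e f = not (eqᵇ e f) ∧
    (incident (proj₁ (ends G e)) f ∨ incident (proj₂ (ends G e)) f)

  -- G^{0-1}: vertex set V(G) ⊎ E(G) encoded as Fin (n + m)
  -- (first n = vertices of G, last m = edges of G).
  --   x = 0 : no edges among V(G)
  --   y = - : complement of the line graph on E(G)
  --   z = 1 : every v ∈ V(G) adjacent to every e ∈ E(G)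
  adj0m1 : Fin (n ℕ.+ m) → Fin (n ℕ.+ m) → Bool
  adj0m1 a b with splitAt n a | splitAt n b
  ... | inj₁ v | inj₁ w = false
  ... | inj₁ v | inj₂ e = true
  ... | inj₂ e | inj₁ w = true
  ... | inj₂ e | inj₂ f = not (eqᵇ e f) ∧ not (adjLine e f)

-- Let R be the vertex–edge incidence matrix of G, so that RRᵀ = Q(G) and RᵀR is 2I plus the
-- adjacency matrix of the line graph. With a = x − m and b = x − m − n + 2r − 2, the matrix
-- xI − Q(G^{0-1}) is the block matrix [aI, −J; −J, bI + RᵀR − J]. Scaling the edge rows by a and
-- subtracting the vertex rows leaves the Schur complement a(bI + RᵀR) − (a + n)J, whose first term
-- has constant column sums a(b + 2r), so the all-ones part only contributes a scalar factor.
-- Finally b^n det(bI + RᵀR) = b^m det(bI + RRᵀ) = b^m (−1)^n f(−b, G). This proves the identity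
-- multiplied by a^(m+1); for a ≠ 0 cancel, and for a = 0 both sides vanish.

module Submission where

open import Defs
open import Data.Bool using (Bool; true; false; if_then_else_; not; _∧_; _∨_)
open import Data.Bool.Properties using (∧-zeroʳ; ∧-identityʳ)
open import Data.Empty using (⊥; ⊥-elim)
open import Data.Fin using (Fin; zero; suc; toℕ; punchIn; fromℕ<; _↑ˡ_; _↑ʳ_; splitAt)
open import Data.Fin.Properties
  using (_≟_; toℕ-injective; toℕ<n; toℕ-fromℕ<; toℕ-↑ˡ; toℕ-↑ʳ; ↑ˡ-injective; ↑ʳ-injective;
         splitAt-↑ˡ; splitAt-↑ʳ; splitAt⁻¹-↑ˡ; splitAt⁻¹-↑ʳ; splitAt-<; splitAt-≥)
  renaming (suc-injective to fsuc-injective)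
open import Data.Integer using (ℤ; +_; -_; _-_; _*_; _+_; _^_; ≢-nonZero)
import Data.Integer.Properties as ℤ
open import Data.Integer.Tactic.RingSolver using (solve-∀)
open import Data.Nat as N using (ℕ; _≤_; zero; suc; z≤n; s≤s)
import Data.Nat.Properties as N
open import Data.Product using (_×_; _,_; proj₁; proj₂)
open import Data.Sum using (_⊎_; inj₁; inj₂; [_,_]′)
open import Function using (_∘′_)
open import Relation.Binary using (tri<; tri≈; tri>)
open import Relation.Binary.PropositionalEquality
open import Relation.Nullary using (yes; no; ¬_)
open import Algebra.Properties.AbelianGroup ℤ.+-0-abelianGroup using (inverseˡ-unique; ∙-cancelˡ)

-- Chosen to be definitionally the entries Defs uses for the adjacency part of signlessLaplacian.
ind : Bool → ℤ
ind b = if b then + 1 else + 0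

δ : ∀ {k} → Fin k → Fin k → ℤ
δ i j = ind (eqᵇ i j)

eqᵇ-refl : ∀ {k} (i : Fin k) → eqᵇ i i ≡ true
eqᵇ-refl i with i ≟ i
... | yes _ = refl
... | no i≢i = ⊥-elim (i≢i refl)

eqᵇ-≢ : ∀ {k} {i j : Fin k} → ¬ i ≡ j → eqᵇ i j ≡ false
eqᵇ-≢ {i = i} {j} i≢j with i ≟ j
... | yes i≡j = ⊥-elim (i≢j i≡j)
... | no _ = refl

eqᵇ-suc : ∀ {k} (i j : Fin k) → eqᵇ (suc i) (suc j) ≡ eqᵇ i j
eqᵇ-suc i j with i ≟ j
... | yes _ = refl
... | no _ = refl

eqᵇ-sym : ∀ {k} (i j : Fin k) → eqᵇ i j ≡ eqᵇ j i
eqᵇ-sym i j with i ≟ j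
... | yes refl = sym (eqᵇ-refl i)
... | no i≢j = sym (eqᵇ-≢ (λ j≡i → i≢j (sym j≡i)))


true≢false : ¬ true ≡ false
true≢false ()

cong₃ : ∀ {A B C D : Set} (f : A → B → C → D) {a a′ b b′ c c′} →
  a ≡ a′ → b ≡ b′ → c ≡ c′ → f a b c ≡ f a′ b′ c′
cong₃ f refl refl refl = refl

sumFin-cong : ∀ {k} {f g : Fin k → ℤ} → (∀ i → f i ≡ g i) → sumFin f ≡ sumFin g
sumFin-cong {zero}  f≗g = refl
sumFin-cong {suc k} f≗g = cong₂ _+_ (f≗g zero) (sumFin-cong (λ i → f≗g (suc i)))

sumFin-zero : ∀ {k} (f : Fin k → ℤ) → (∀ i → f i ≡ + 0) → sumFin f ≡ + 0
sumFin-zero {zero}  f f≗0 = refl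
sumFin-zero {suc k} f f≗0 = cong₂ _+_ (f≗0 zero) (sumFin-zero (λ i → f (suc i)) (λ i → f≗0 (suc i)))

sumFin-+ : ∀ {k} (f g : Fin k → ℤ) → sumFin (λ i → f i + g i) ≡ sumFin f + sumFin g
sumFin-+ {zero}  f g = refl
sumFin-+ {suc k} f g = trans (cong (_+_ (f zero + g zero)) (sumFin-+ (λ i → f (suc i)) (λ i → g (suc i))))
  (interchange (f zero) (g zero) _ _)
  where interchange : ∀ a b c d → a + b + (c + d) ≡ a + c + (b + d)
        interchange = solve-∀

sumFin-*ˡ : ∀ {k} (c : ℤ) (f : Fin k → ℤ) → sumFin (λ i → c * f i) ≡ c * sumFin f
sumFin-*ˡ {zero}  c f = sym (ℤ.*-zeroʳ c)
sumFin-*ˡ {suc k} c f = trans (cong (_+_ (c * f zero)) (sumFin-*ˡ c (λ i → f (suc i))))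
  (sym (ℤ.*-distribˡ-+ c _ _))

sumFin-*ʳ : ∀ {k} (c : ℤ) (f : Fin k → ℤ) → sumFin (λ i → f i * c) ≡ sumFin f * c
sumFin-*ʳ c f = trans (sumFin-cong (λ i → ℤ.*-comm (f i) c))
  (trans (sumFin-*ˡ c f) (ℤ.*-comm c (sumFin f)))

sumFin-neg : ∀ {k} (f : Fin k → ℤ) → sumFin (λ i → - f i) ≡ - sumFin f
sumFin-neg {zero}  f = refl
sumFin-neg {suc k} f = trans (cong (_+_ (- f zero)) (sumFin-neg (λ i → f (suc i))))
  (sym (ℤ.neg-distrib-+ (f zero) _))

sumFin-const : ∀ k (c : ℤ) → sumFin {k} (λ _ → c) ≡ + k * c
sumFin-const zero    c = refl
sumFin-const (suc k) c = trans (cong (_+_ c) (sumFin-const k c)) (sym (ℤ.suc-* (+ k) c))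

sumFin-comm : ∀ {k l} (f : Fin k → Fin l → ℤ) →
  sumFin (λ i → sumFin (f i)) ≡ sumFin (λ j → sumFin (λ i → f i j))
sumFin-comm {zero} {l} f = sym (sumFin-zero {l} (λ _ → + 0) (λ _ → refl))
sumFin-comm {suc k} f = trans (cong (_+_ (sumFin (f zero))) (sumFin-comm (λ i → f (suc i))))
  (sym (sumFin-+ (f zero) _))

sumFin-splitAt : ∀ p q (f : Fin (p N.+ q) → ℤ) →
  sumFin f ≡ sumFin (λ i → f (i ↑ˡ q)) + sumFin (λ i → f (p ↑ʳ i))
sumFin-splitAt zero    q f = sym (ℤ.+-identityˡ _)
sumFin-splitAt (suc p) q f = trans (cong (_+_ (f zero)) (sumFin-splitAt p q (λ i → f (suc i))))
  (sym (ℤ.+-assoc (f zero) _ _))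

sumFin-select : ∀ {k} (i : Fin k) (g : Fin k → ℤ) →
  sumFin (λ j → if eqᵇ j i then g j else + 0) ≡ g i
sumFin-select {suc k} zero g = trans (cong (_+_ (g zero)) (sumFin-zero {k} _ (λ _ → refl))) (ℤ.+-identityʳ _)
sumFin-select (suc i) g = trans (ℤ.+-identityˡ _)
  (trans (sumFin-cong (λ j → cong (λ b → if b then g (suc j) else + 0) (eqᵇ-suc j i)))
         (sumFin-select i (λ j → g (suc j))))

sumFin-*δ : ∀ {k} (h : Fin k → ℤ) (j : Fin k) → sumFin (λ i → h i * δ i j) ≡ h j
sumFin-*δ h j = trans (sumFin-cong select) (sumFin-select j h)
  where select : ∀ i → h i * δ i j ≡ (if eqᵇ i j then h i else + 0)
        select i with eqᵇ i j
        ... | true  = ℤ.*-identityʳ (h i)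
        ... | false = ℤ.*-zeroʳ (h i)

sumFin-δ : ∀ {k} (i : Fin k) → sumFin (δ i) ≡ + 1
sumFin-δ i = trans (sumFin-cong (λ j → trans (cong ind (eqᵇ-sym i j)) (sym (ℤ.*-identityˡ (δ j i)))))
  (sumFin-*δ (λ _ → + 1) i)

sumFin-punchIn : ∀ {k} (j : Fin (suc k)) (g : Fin (suc k) → ℤ) →
  sumFin (λ l → g (punchIn j l)) ≡ sumFin (λ d → if eqᵇ d j then + 0 else g d)
sumFin-punchIn         zero    g = sym (ℤ.+-identityˡ _)
sumFin-punchIn {suc k} (suc j) g = cong (_+_ (g zero))
  (trans (sumFin-punchIn j (λ d → g (suc d)))
         (sumFin-cong (λ d → cong (λ b → if b then + 0 else g (suc d)) (sym (eqᵇ-suc d j)))))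

sumFin-ind : ∀ {k} (p : Fin k → Bool) → sumFin (λ i → ind (p i)) ≡ + countFin p
sumFin-ind {zero}  p = refl
sumFin-ind {suc k} p with p zero
... | true  = cong (_+_ (+ 1)) (sumFin-ind (λ i → p (suc i)))
... | false = trans (ℤ.+-identityˡ _) (sumFin-ind (λ i → p (suc i)))


prodFin : ∀ {k} → (Fin k → ℤ) → ℤ
prodFin {zero}  w = + 1
prodFin {suc k} w = w zero * prodFin (λ i → w (suc i))

prodFin-cong : ∀ {k} {f g : Fin k → ℤ} → (∀ i → f i ≡ g i) → prodFin f ≡ prodFin g
prodFin-cong {zero}  f≗g = refl
prodFin-cong {suc k} f≗g = cong₂ _*_ (f≗g zero) (prodFin-cong (λ i → f≗g (suc i)))

prodFin-const : ∀ k (c : ℤ) → prodFin {k} (λ _ → c) ≡ c ^ k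
prodFin-const zero    c = refl
prodFin-const (suc k) c = cong (c *_) (prodFin-const k c)

prodFin-splitAt : ∀ p q (f : Fin (p N.+ q) → ℤ) →
  prodFin f ≡ prodFin (λ i → f (i ↑ˡ q)) * prodFin (λ i → f (p ↑ʳ i))
prodFin-splitAt zero    q f = sym (ℤ.*-identityˡ _)
prodFin-splitAt (suc p) q f = trans (cong (f zero *_) (prodFin-splitAt p q (λ i → f (suc i))))
  (sym (ℤ.*-assoc (f zero) _ _))

sign : ∀ {k} → Fin k → ℤ
sign j = (- + 1) ^ toℕ j

minor : ∀ {k} → Matrix (suc k) → Fin (suc k) → Matrix k
minor M j a b = M (suc a) (punchIn j b)

laplaceTerm : ∀ {k} → Matrix (suc k) → Fin (suc k) → ℤ
laplaceTerm M j = sign j * M zero j * det (minor M j)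

det-cong : ∀ {k} {M N : Matrix k} → (∀ i j → M i j ≡ N i j) → det M ≡ det N
det-cong {zero}  M≗N = refl
det-cong {suc k} M≗N = sumFin-cong (λ j →
  cong₂ _*_ (cong (sign j *_) (M≗N zero j)) (det-cong (λ a b → M≗N (suc a) (punchIn j b))))

AgreeOffRow : ∀ {k} → Fin k → Matrix k → Matrix k → Set
AgreeOffRow i M N = ∀ a → ¬ a ≡ i → ∀ b → M a b ≡ N a b

det-linearRow : ∀ {k} (i : Fin k) (α β : ℤ) (M N P : Matrix k) →
  AgreeOffRow i M N → AgreeOffRow i M P → (∀ b → M i b ≡ α * N i b + β * P i b) →
  det M ≡ α * det N + β * det P
det-linearRow {suc k} i α β M N P M~N M~P Mᵢ =
  trans (sumFin-cong (term i M~N M~P Mᵢ))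
        (trans (sumFin-+ (λ j → α * laplaceTerm N j) (λ j → β * laplaceTerm P j))
               (cong₂ _+_ (sumFin-*ˡ α (laplaceTerm N)) (sumFin-*ˡ β (laplaceTerm P))))
  where
    open ≡-Reasoning
    term : ∀ i → AgreeOffRow i M N → AgreeOffRow i M P → (∀ b → M i b ≡ α * N i b + β * P i b) →
      ∀ j → laplaceTerm M j ≡ α * laplaceTerm N j + β * laplaceTerm P j
    term zero M~N M~P M₀ j = begin
      sign j * M zero j * det (minor M j)
        ≡⟨ cong₂ (λ x d → sign j * x * d) (M₀ j) (det-cong (λ a b → M~N (suc a) (λ ()) (punchIn j b))) ⟩
      sign j * (α * N zero j + β * P zero j) * det (minor N j)
        ≡⟨ distrib (sign j) α β (N zero j) (P zero j) _ ⟩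
      α * (sign j * N zero j * det (minor N j)) + β * (sign j * P zero j * det (minor N j))
        ≡⟨ cong (λ d → α * (sign j * N zero j * det (minor N j)) + β * (sign j * P zero j * d))
                (det-cong (λ a b → trans (sym (M~N (suc a) (λ ()) (punchIn j b))) (M~P (suc a) (λ ()) (punchIn j b)))) ⟩
      α * (sign j * N zero j * det (minor N j)) + β * (sign j * P zero j * det (minor P j)) ∎
      where distrib : ∀ s a b x y d → s * (a * x + b * y) * d ≡ a * (s * x * d) + b * (s * y * d)
            distrib = solve-∀
    term (suc i) M~N M~P Mᵢ j = begin
      sign j * M zero j * det (minor M j)
        ≡⟨ cong₂ (λ x d → sign j * x * d) (M~N zero (λ ()) j)
             (det-linearRow i α β (minor M j) (minor N j) (minor P j)
               (λ a a≢i b → M~N (suc a) (λ e → a≢i (fsuc-injective e)) (punchIn j b))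
               (λ a a≢i b → M~P (suc a) (λ e → a≢i (fsuc-injective e)) (punchIn j b))
               (λ b → Mᵢ (punchIn j b))) ⟩
      sign j * N zero j * (α * det (minor N j) + β * det (minor P j))
        ≡⟨ distrib (sign j) (N zero j) α β _ _ ⟩
      α * (sign j * N zero j * det (minor N j)) + β * (sign j * N zero j * det (minor P j))
        ≡⟨ cong (λ x → α * (sign j * N zero j * det (minor N j)) + β * (sign j * x * det (minor P j)))
                (trans (sym (M~N zero (λ ()) j)) (M~P zero (λ ()) j)) ⟩
      α * (sign j * N zero j * det (minor N j)) + β * (sign j * P zero j * det (minor P j)) ∎
      where distrib : ∀ s x a b d e → s * x * (a * d + b * e) ≡ a * (s * x * d) + b * (s * x * e)
            distrib = solve-∀

det-zeroRow : ∀ {k} (M : Matrix k) (i : Fin k) → (∀ b → M i b ≡ + 0) → det M ≡ + 0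
det-zeroRow M i Mᵢ≗0 = det-linearRow i (+ 0) (+ 0) M M M (λ _ _ _ → refl) (λ _ _ _ → refl) Mᵢ≗0

det-scaleRows : ∀ {k} (w : Fin k → ℤ) (M : Matrix k) → det (λ a b → w a * M a b) ≡ prodFin w * det M
det-scaleRows {zero}  w M = refl
det-scaleRows {suc k} w M = begin
  sumFin (λ j → sign j * (w zero * M zero j) * det (λ a b → w (suc a) * minor M j a b))
    ≡⟨ sumFin-cong (λ j → cong (sign j * (w zero * M zero j) *_) (det-scaleRows (λ a → w (suc a)) (minor M j))) ⟩
  sumFin (λ j → sign j * (w zero * M zero j) * (prodFin (λ a → w (suc a)) * det (minor M j)))
    ≡⟨ sumFin-cong (λ j → regroup (sign j) (w zero) (M zero j) (prodFin (λ a → w (suc a))) (det (minor M j))) ⟩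
  sumFin (λ j → prodFin w * laplaceTerm M j)
    ≡⟨ sumFin-*ˡ (prodFin w) (laplaceTerm M) ⟩
  prodFin w * det M ∎
  where open ≡-Reasoning
        regroup : ∀ s w₀ x p d → s * (w₀ * x) * (p * d) ≡ (w₀ * p) * (s * x * d)
        regroup = solve-∀

det-δ : ∀ k → det {k} δ ≡ + 1
det-δ zero    = refl
det-δ (suc k) = cong₂ _+_ diagonal (sumFin-zero _ offDiagonal)
  where
    diagonal : laplaceTerm {k} δ zero ≡ + 1
    diagonal = trans (ℤ.*-identityˡ _)
      (trans (det-cong {k} (λ a b → cong ind (eqᵇ-suc a b))) (det-δ k))
    offDiagonal : ∀ j → laplaceTerm {k} δ (suc j) ≡ + 0
    offDiagonal j = cong (_* det (minor {k} δ (suc j))) (ℤ.*-zeroʳ (sign {suc k} (suc j)))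

det-scale : ∀ {k} (c : ℤ) (M : Matrix k) → det (λ a b → c * M a b) ≡ c ^ k * det M
det-scale {k} c M = trans (det-scaleRows (λ _ → c) M) (cong (_* det M) (prodFin-const k c))

det-scalarδ : ∀ k (c : ℤ) → det {k} (λ a b → c * δ a b) ≡ c ^ k
det-scalarδ k c = trans (det-scale {k} c δ) (trans (cong (c ^ k *_) (det-δ k)) (ℤ.*-identityʳ (c ^ k)))

-- Left inverse of punchIn j, made total by a junk value at d = j.
punchOut′ : ∀ {k} → Fin (suc (suc k)) → Fin (suc (suc k)) → Fin (suc k)
punchOut′ zero    zero    = zero
punchOut′ zero    (suc d) = d
punchOut′ (suc j) zero    = zero
punchOut′ {zero}  (suc j) (suc d) = zero
punchOut′ {suc k} (suc j) (suc d) = suc (punchOut′ j d)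

punchOut′-punchIn : ∀ {k} (j : Fin (suc (suc k))) (l : Fin (suc k)) → punchOut′ j (punchIn j l) ≡ l
punchOut′-punchIn zero    l       = refl
punchOut′-punchIn (suc j) zero    = refl
punchOut′-punchIn {suc k} (suc j) (suc l) = cong suc (punchOut′-punchIn j l)

punchIn-punchOut′-comm : ∀ {k} (j d : Fin (suc (suc k))) → ¬ j ≡ d → ∀ b →
  punchIn j (punchIn (punchOut′ j d) b) ≡ punchIn d (punchIn (punchOut′ d j) b)
punchIn-punchOut′-comm zero    zero    j≢d b = ⊥-elim (j≢d refl)
punchIn-punchOut′-comm zero    (suc d) j≢d b = refl
punchIn-punchOut′-comm (suc j) zero    j≢d b = refl
punchIn-punchOut′-comm {suc k} (suc j) (suc d) j≢d zero    = refl
punchIn-punchOut′-comm {suc k} (suc j) (suc d) j≢d (suc b) =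
  cong suc (punchIn-punchOut′-comm j d (λ j≡d → j≢d (cong suc j≡d)) b)

toℕ-punchOut′-exchange : ∀ {k} (j d : Fin (suc (suc k))) → toℕ j N.< toℕ d →
  suc (toℕ j N.+ toℕ (punchOut′ j d)) ≡ toℕ d N.+ toℕ (punchOut′ d j)
toℕ-punchOut′-exchange zero    (suc d) _ = sym (N.+-identityʳ _)
toℕ-punchOut′-exchange {zero}  (suc zero) (suc zero) (s≤s ())
toℕ-punchOut′-exchange {suc k} (suc j) (suc d) (s≤s j<d) = begin
  suc (suc (toℕ j) N.+ suc (toℕ (punchOut′ j d)))  ≡⟨ cong (suc ∘′ suc) (N.+-suc (toℕ j) _) ⟩
  suc (suc (suc (toℕ j N.+ toℕ (punchOut′ j d)))) ≡⟨ cong (suc ∘′ suc) (toℕ-punchOut′-exchange j d j<d) ⟩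
  suc (suc (toℕ d N.+ toℕ (punchOut′ d j)))       ≡⟨ cong suc (sym (N.+-suc (toℕ d) _)) ⟩
  suc (toℕ d) N.+ suc (toℕ (punchOut′ d j))       ∎
  where open ≡-Reasoning

sign-* : ∀ {k l} (i : Fin k) (j : Fin l) → sign i * sign j ≡ (- + 1) ^ (toℕ i N.+ toℕ j)
sign-* i j = sym (ℤ.^-distribˡ-+-* (- + 1) (toℕ i) (toℕ j))

sign-punchOut′-exchange : ∀ {k} (j d : Fin (suc (suc k))) → toℕ j N.< toℕ d →
  sign d * sign (punchOut′ d j) ≡ - (sign j * sign (punchOut′ j d))
sign-punchOut′-exchange j d j<d = begin
  sign d * sign (punchOut′ d j)                       ≡⟨ sign-* d _ ⟩
  (- + 1) ^ (toℕ d N.+ toℕ (punchOut′ d j))           ≡⟨ cong ((- + 1) ^_) (sym (toℕ-punchOut′-exchange j d j<d)) ⟩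
  - + 1 * (- + 1) ^ (toℕ j N.+ toℕ (punchOut′ j d))   ≡⟨ ℤ.-1*i≡-i _ ⟩
  - (- + 1) ^ (toℕ j N.+ toℕ (punchOut′ j d))         ≡⟨ cong -_ (sym (sign-* j _)) ⟩
  - (sign j * sign (punchOut′ j d))                   ∎
  where open ≡-Reasoning

sign-punchOut′-antisym : ∀ {k} (j d : Fin (suc (suc k))) → ¬ j ≡ d →
  sign j * sign (punchOut′ j d) ≡ - (sign d * sign (punchOut′ d j))
sign-punchOut′-antisym j d j≢d with N.<-cmp (toℕ j) (toℕ d)
... | tri< j<d _ _ = trans (sym (ℤ.neg-involutive _)) (cong -_ (sym (sign-punchOut′-exchange j d j<d)))
... | tri≈ _ j≡d _ = ⊥-elim (j≢d (toℕ-injective j≡d))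
... | tri> _ _ d<j = sign-punchOut′-exchange d j d<j

-- Expanding along row 0 and then along the old row 1 writes det as a double sum over
-- ordered pairs of distinct columns; exchanging the two rows exchanges the pair and the sign.
-- Φ f is the determinant of the remaining rows restricted to the columns f.
module DoubleExpansion {k : ℕ} (Φ : (Fin k → Fin (suc (suc k))) → ℤ)
  (Φ-cong : ∀ f g → (∀ b → f b ≡ g b) → Φ f ≡ Φ g) where

  Row : Set
  Row = Fin (suc (suc k)) → ℤ

  term : Row → Row → Fin (suc (suc k)) → Fin (suc k) → ℤ
  term A B j l = sign j * sign l * A j * B (punchIn j l) * Φ (λ b → punchIn j (punchIn l b))

  pairSummand : Row → Row → Fin (suc (suc k)) → Fin (suc (suc k)) → ℤ
  pairSummand A B j d = sign j * sign (punchOut′ j d) * A j * B d * Φ (λ b → punchIn j (punchIn (punchOut′ j d) b))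

  pairTerm : Row → Row → Fin (suc (suc k)) → Fin (suc (suc k)) → ℤ
  pairTerm A B j d = if eqᵇ d j then + 0 else pairSummand A B j d

  sumFin-term : ∀ A B j → sumFin (term A B j) ≡ sumFin (pairTerm A B j)
  sumFin-term A B j = trans
    (sumFin-cong (λ l → cong (λ l′ → sign j * sign l′ * A j * B (punchIn j l) * Φ (λ b → punchIn j (punchIn l′ b)))
                             (sym (punchOut′-punchIn j l))))
    (sumFin-punchIn j (pairSummand A B j))

  pairTerm-antisym : ∀ A B j d → pairTerm A B j d ≡ - pairTerm B A d j
  pairTerm-antisym A B j d with j ≟ d
  ... | yes refl rewrite eqᵇ-refl j = refl
  ... | no j≢d rewrite eqᵇ-≢ (λ d≡j → j≢d (sym d≡j)) = begin
    sign j * sign (punchOut′ j d) * A j * B d * Φ (λ b → punchIn j (punchIn (punchOut′ j d) b))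
      ≡⟨ cong₂ (λ s φ → s * A j * B d * φ) (sign-punchOut′-antisym j d j≢d)
               (Φ-cong _ _ (punchIn-punchOut′-comm j d j≢d)) ⟩
    - (sign d * sign (punchOut′ d j)) * A j * B d * Φ (λ b → punchIn d (punchIn (punchOut′ d j) b))
      ≡⟨ regroup (sign d * sign (punchOut′ d j)) (A j) (B d) _ ⟩
    - (sign d * sign (punchOut′ d j) * B d * A j * Φ (λ b → punchIn d (punchIn (punchOut′ d j) b))) ∎
    where open ≡-Reasoning
          regroup : ∀ s a b φ → - s * a * b * φ ≡ - (s * b * a * φ)
          regroup = solve-∀

  doubleSum-antisym : ∀ A B →
    sumFin (λ j → sumFin (term A B j)) ≡ - sumFin (λ j → sumFin (term B A j))
  doubleSum-antisym A B = begin
    sumFin (λ j → sumFin (term A B j))                        ≡⟨ sumFin-cong (sumFin-term A B) ⟩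
    sumFin (λ j → sumFin (pairTerm A B j))                    ≡⟨ sumFin-comm (pairTerm A B) ⟩
    sumFin (λ d → sumFin (λ j → pairTerm A B j d))
      ≡⟨ sumFin-cong (λ d → sumFin-cong (λ j → pairTerm-antisym A B j d)) ⟩
    sumFin (λ d → sumFin (λ j → - pairTerm B A d j))          ≡⟨ sumFin-cong (λ d → sumFin-neg (pairTerm B A d)) ⟩
    sumFin (λ d → - sumFin (pairTerm B A d))                  ≡⟨ sumFin-neg (λ d → sumFin (pairTerm B A d)) ⟩
    - sumFin (λ d → sumFin (pairTerm B A d))                  ≡⟨ cong -_ (sym (sumFin-cong (sumFin-term B A))) ⟩
    - sumFin (λ j → sumFin (term B A j))                      ∎
    where open ≡-Reasoning

lowerRowsDet : ∀ {k} → Matrix (suc (suc k)) → (Fin k → Fin (suc (suc k))) → ℤ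
lowerRowsDet M f = det (λ a b → M (suc (suc a)) (f b))

lowerRowsDet-cong : ∀ {k} (M : Matrix (suc (suc k))) f g → (∀ b → f b ≡ g b) → lowerRowsDet M f ≡ lowerRowsDet M g
lowerRowsDet-cong M f g f≗g = det-cong (λ a b → cong (M (suc (suc a))) (f≗g b))

det-doubleExpansion : ∀ {k} (M : Matrix (suc (suc k))) →
  det M ≡ sumFin (λ j → sumFin (DoubleExpansion.term (lowerRowsDet M) (lowerRowsDet-cong M) (M zero) (M (suc zero)) j))
det-doubleExpansion M = sumFin-cong (λ j → trans
  (sym (sumFin-*ˡ (sign j * M zero j) (laplaceTerm (minor M j))))
  (sumFin-cong (λ l → regroup (sign j) (M zero j) (sign l) (M (suc zero) (punchIn j l)) (det (minor (minor M j) l)))))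
  where regroup : ∀ s a t b φ → s * a * (t * b * φ) ≡ s * t * a * b * φ
        regroup = solve-∀

record RowsSwapped {k} (i j : Fin k) (M N : Matrix k) : Set where
  field
    at-i      : ∀ b → N i b ≡ M j b
    at-j      : ∀ b → N j b ≡ M i b
    elsewhere : ∀ a → ¬ a ≡ i → ¬ a ≡ j → ∀ b → N a b ≡ M a b

det-swap01 : ∀ {k} (M N : Matrix (suc (suc k))) → RowsSwapped zero (suc zero) M N → det N ≡ - det M
det-swap01 M N swapped = begin
  det N
    ≡⟨ det-doubleExpansion N ⟩
  sumFin (λ j → sumFin (term (lowerRowsDet N) (lowerRowsDet-cong N) (N zero) (N (suc zero)) j))
    ≡⟨ sumFin-cong (λ j → sumFin-cong (λ l →
         cong₃ (λ x y φ → sign j * sign l * x * y * φ) (at-i j) (at-j (punchIn j l))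
               (det-cong (λ a b → elsewhere (suc (suc a)) (λ ()) (λ ()) (punchIn j (punchIn l b)))))) ⟩
  sumFin (λ j → sumFin (term (lowerRowsDet M) (lowerRowsDet-cong M) (M (suc zero)) (M zero) j))
    ≡⟨ doubleSum-antisym (lowerRowsDet M) (lowerRowsDet-cong M) (M (suc zero)) (M zero) ⟩
  - sumFin (λ j → sumFin (term (lowerRowsDet M) (lowerRowsDet-cong M) (M zero) (M (suc zero)) j))
    ≡⟨ cong -_ (sym (det-doubleExpansion M)) ⟩
  - det M ∎
  where open ≡-Reasoning
        open RowsSwapped swapped
        open DoubleExpansion using (term; doubleSum-antisym)

setRow : ∀ {k} → Matrix k → Fin k → (Fin k → ℤ) → Matrix k
setRow M i u a b = if eqᵇ a i then u b else M a b

setRow-≡ : ∀ {k} (M : Matrix k) i u b → setRow M i u i b ≡ u b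
setRow-≡ M i u b rewrite eqᵇ-refl i = refl

setRow-≢ : ∀ {k} (M : Matrix k) i u {a} b → ¬ a ≡ i → setRow M i u a b ≡ M a b
setRow-≢ M i u b a≢i rewrite eqᵇ-≢ a≢i = refl

det-setRow-+ : ∀ {k} (M : Matrix k) i (u v : Fin k → ℤ) →
  det (setRow M i (λ b → u b + v b)) ≡ det (setRow M i u) + det (setRow M i v)
det-setRow-+ {k} M i u v = trans
  (det-linearRow i (+ 1) (+ 1) (setRow M i w) (setRow M i u) (setRow M i v)
    (λ a a≢i b → trans (setRow-≢ M i w b a≢i) (sym (setRow-≢ M i u b a≢i)))
    (λ a a≢i b → trans (setRow-≢ M i w b a≢i) (sym (setRow-≢ M i v b a≢i)))
    (λ b → trans (setRow-≡ M i w b) (sym (trans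
      (cong₂ (λ x y → + 1 * x + + 1 * y) (setRow-≡ M i u b) (setRow-≡ M i v b))
      (cong₂ _+_ (ℤ.*-identityˡ (u b)) (ℤ.*-identityˡ (v b)))))))
  (cong₂ _+_ (ℤ.*-identityˡ (det (setRow M i u))) (ℤ.*-identityˡ (det (setRow M i v))))
  where w : Fin k → ℤ
        w b = u b + v b

EqualRowsVanish : ∀ {k} → Fin k → Fin k → Set
EqualRowsVanish {k} i j = ∀ (M : Matrix k) → (∀ b → M i b ≡ M j b) → det M ≡ + 0

≡-neg⇒≡0 : ∀ x → x ≡ - x → x ≡ + 0
≡-neg⇒≡0 x x≡-x = ℤ.*-cancelˡ-≡ (+ 2) x (+ 0) (trans (double x) (trans (cong (_+_ x) x≡-x) (ℤ.+-inverseʳ x)))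
  where double : ∀ x → + 2 * x ≡ x + x
        double = solve-∀

-- Alternating and bilinear in rows i and j gives antisymmetric, via D(p+q,p+q) = 0.
module SwapRows {k} {i j : Fin k} (i≢j : ¬ i ≡ j) (vanish : EqualRowsVanish i j) (M : Matrix k) where

  setRows : (Fin k → ℤ) → (Fin k → ℤ) → Matrix k
  setRows p q = setRow (setRow M i p) j q

  setRows-≗ : ∀ p q (N : Matrix k) → (∀ b → N i b ≡ p b) → (∀ b → N j b ≡ q b) →
    (∀ a → ¬ a ≡ i → ¬ a ≡ j → ∀ b → N a b ≡ M a b) → det (setRows p q) ≡ det N
  setRows-≗ p q N Nᵢ Nⱼ N-elsewhere = det-cong pointwise
    where
      pointwise : ∀ a b → setRows p q a b ≡ N a b
      pointwise a b with a ≟ j | a ≟ i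
      ... | yes refl | _        = sym (Nⱼ b)
      ... | no _     | yes refl = sym (Nᵢ b)
      ... | no a≢j   | no a≢i   = sym (N-elsewhere a a≢i a≢j b)

  D : (Fin k → ℤ) → (Fin k → ℤ) → ℤ
  D p q = det (setRows p q)

  D-+ʳ : ∀ p q q′ → D p (λ b → q b + q′ b) ≡ D p q + D p q′
  D-+ʳ p = det-setRow-+ (setRow M i p) j

  D-setRowsˡ : ∀ p q → D p q ≡ det (setRow (setRow M j q) i p)
  D-setRowsˡ p q = setRows-≗ p q (setRow (setRow M j q) i p) (setRow-≡ (setRow M j q) i p)
    (λ b → trans (setRow-≢ (setRow M j q) i p b (λ j≡i → i≢j (sym j≡i))) (setRow-≡ M j q b))
    (λ a a≢i a≢j b → trans (setRow-≢ (setRow M j q) i p b a≢i) (setRow-≢ M j q b a≢j))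

  D-+ˡ : ∀ p p′ q → D (λ b → p b + p′ b) q ≡ D p q + D p′ q
  D-+ˡ p p′ q = trans (D-setRowsˡ _ q)
    (trans (det-setRow-+ (setRow M j q) i p p′) (sym (cong₂ _+_ (D-setRowsˡ p q) (D-setRowsˡ p′ q))))

  D-diagonal : ∀ p → D p p ≡ + 0
  D-diagonal p = vanish (setRows p p) (λ b → trans (setRow-≢ (setRow M i p) j p b i≢j)
                                        (trans (setRow-≡ M i p b) (sym (setRow-≡ (setRow M i p) j p b))))

  D-antisym : ∀ p q → D p q ≡ - D q p
  D-antisym p q = inverseˡ-unique (D p q) (D q p) (begin
    D p q + D q p                                 ≡⟨ insertDiagonal (D p q) (D q p) ⟩
    (+ 0 + D p q) + (D q p + + 0)                 ≡⟨ sym (cong₂ (λ x y → (x + D p q) + (D q p + y)) (D-diagonal p) (D-diagonal q)) ⟩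
    (D p p + D p q) + (D q p + D q q)             ≡⟨ sym (cong₂ _+_ (D-+ʳ p p q) (D-+ʳ q p q)) ⟩
    D p (λ b → p b + q b) + D q (λ b → p b + q b) ≡⟨ sym (D-+ˡ p q _) ⟩
    D (λ b → p b + q b) (λ b → p b + q b)         ≡⟨ D-diagonal _ ⟩
    + 0                                           ∎)
    where open ≡-Reasoning
          insertDiagonal : ∀ x y → x + y ≡ (+ 0 + x) + (y + + 0)
          insertDiagonal = solve-∀

det-swapRows : ∀ {k} {i j : Fin k} → ¬ i ≡ j → EqualRowsVanish i j →
  ∀ (M N : Matrix k) → RowsSwapped i j M N → det N ≡ - det M
det-swapRows {i = i} {j} i≢j vanish M N swapped = begin
  det N        ≡⟨ sym (setRows-≗ (M j) (M i) N at-i at-j elsewhere) ⟩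
  D (M j) (M i) ≡⟨ D-antisym (M j) (M i) ⟩
  - D (M i) (M j) ≡⟨ cong -_ (setRows-≗ (M i) (M j) M (λ _ → refl) (λ _ → refl) (λ _ _ _ _ → refl)) ⟩
  - det M ∎
  where open ≡-Reasoning
        open RowsSwapped swapped
        open SwapRows i≢j vanish M


det-swapRows-suc : ∀ {k} {i j : Fin k} → (∀ (M N : Matrix k) → RowsSwapped i j M N → det N ≡ - det M) →
  ∀ (M N : Matrix (suc k)) → RowsSwapped (suc i) (suc j) M N → det N ≡ - det M
det-swapRows-suc swapMinors M N swapped = trans (sumFin-cong negatedTerm) (sumFin-neg (laplaceTerm M))
  where
    open RowsSwapped swapped
    minorsSwapped : ∀ c → RowsSwapped _ _ (minor M c) (minor N c)
    minorsSwapped c = record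
      { at-i = λ b → at-i (punchIn c b)
      ; at-j = λ b → at-j (punchIn c b)
      ; elsewhere = λ a a≢i a≢j b →
          elsewhere (suc a) (λ e → a≢i (fsuc-injective e)) (λ e → a≢j (fsuc-injective e)) (punchIn c b) }
    negatedTerm : ∀ c → laplaceTerm N c ≡ - laplaceTerm M c
    negatedTerm c = trans
      (cong₂ (λ x d → sign c * x * d) (elsewhere zero (λ ()) (λ ()) c) (swapMinors (minor M c) (minor N c) (minorsSwapped c)))
      (sym (ℤ.neg-distribʳ-* (sign c * M zero c) (det (minor M c))))

rowsSwapped-setRows : ∀ {k} {i j : Fin k} → ¬ i ≡ j → (M : Matrix k) →
  RowsSwapped i j M (setRow (setRow M i (M j)) j (M i))
rowsSwapped-setRows {i = i} {j} i≢j M = record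
  { at-i = λ b → trans (setRow-≢ (setRow M i (M j)) j (M i) b i≢j) (setRow-≡ M i (M j) b)
  ; at-j = setRow-≡ (setRow M i (M j)) j (M i)
  ; elsewhere = λ a a≢i a≢j b → trans (setRow-≢ (setRow M i (M j)) j (M i) b a≢j) (setRow-≢ M i (M j) b a≢i) }

det-equalRows01 : ∀ {k} (M : Matrix (suc (suc k))) → (∀ b → M zero b ≡ M (suc zero) b) → det M ≡ + 0
det-equalRows01 M M₀≗M₁ = ≡-neg⇒≡0 (det M)
  (det-swap01 M M record { at-i = M₀≗M₁ ; at-j = λ b → sym (M₀≗M₁ b) ; elsewhere = λ _ _ _ _ → refl })

mutual
  det-equalRows : ∀ {k} (M : Matrix k) (i j : Fin k) → ¬ i ≡ j → (∀ b → M i b ≡ M j b) → det M ≡ + 0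
  det-equalRows M zero    zero    i≢j _     = ⊥-elim (i≢j refl)
  det-equalRows M zero    (suc j) _   M₀≗Mⱼ = det-equalRows₀ M j M₀≗Mⱼ
  det-equalRows M (suc i) zero    _   Mᵢ≗M₀ = det-equalRows₀ M i (λ b → sym (Mᵢ≗M₀ b))
  det-equalRows M (suc i) (suc j) i≢j Mᵢ≗Mⱼ = sumFin-zero (laplaceTerm M) (λ c →
    trans (cong (sign c * M zero c *_)
                (det-equalRows (minor M c) i j (λ e → i≢j (cong suc e)) (λ b → Mᵢ≗Mⱼ (punchIn c b))))
          (ℤ.*-zeroʳ (sign c * M zero c)))

  -- For rows 0 and j+2, first move row j+2 to position 1 by a swap inside the minors.
  det-equalRows₀ : ∀ {k} (M : Matrix (suc k)) (j : Fin k) → (∀ b → M zero b ≡ M (suc j) b) → det M ≡ + 0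
  det-equalRows₀ {suc k} M zero    M₀≗M₁ = det-equalRows01 M M₀≗M₁
  det-equalRows₀ {suc k} M (suc j) M₀≗Mⱼ = begin
    det M          ≡⟨ sym (ℤ.neg-involutive (det M)) ⟩
    - - det M      ≡⟨ cong -_ (sym (det-swapRows-suc
                        (det-swapRows (λ ()) (λ A → det-equalRows A zero (suc j) (λ ())))
                        M M′ swapped)) ⟩
    - det M′       ≡⟨ cong -_ (det-equalRows01 M′ (λ b → trans (M₀≗Mⱼ b) (sym (RowsSwapped.at-i swapped b)))) ⟩
    + 0            ∎
    where
      open ≡-Reasoning
      M′ : Matrix (suc (suc k))
      M′ = setRow (setRow M (suc zero) (M (suc (suc j)))) (suc (suc j)) (M (suc zero))
      swapped : RowsSwapped (suc zero) (suc (suc j)) M M′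
      swapped = rowsSwapped-setRows (λ ()) M

det-setRow-* : ∀ {k} (M : Matrix k) i (c : ℤ) (u : Fin k → ℤ) →
  det (setRow M i (λ b → c * u b)) ≡ c * det (setRow M i u)
det-setRow-* {k} M i c u = trans
  (det-linearRow i c (+ 0) (setRow M i cu) (setRow M i u) (setRow M i u) offRow offRow
    (λ b → trans (setRow-≡ M i cu b)
                 (sym (trans (cong (λ x → c * x + + 0 * x) (setRow-≡ M i u b)) (ℤ.+-identityʳ (c * u b))))))
  (ℤ.+-identityʳ (c * det (setRow M i u)))
  where
    cu : Fin k → ℤ
    cu b = c * u b
    offRow : AgreeOffRow i (setRow M i cu) (setRow M i u)
    offRow a a≢i b = trans (setRow-≢ M i cu b a≢i) (sym (setRow-≢ M i u b a≢i))

det-setRow-sumFin : ∀ {k} K (M : Matrix k) i (c : Fin K → ℤ) (V : Fin K → Fin k → ℤ) →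
  det (setRow M i (λ b → sumFin (λ l → c l * V l b))) ≡ sumFin (λ l → c l * det (setRow M i (V l)))
det-setRow-sumFin zero    M i c V = det-zeroRow _ i (setRow-≡ M i (λ _ → + 0))
det-setRow-sumFin {k} (suc K) M i c V = begin
  det (setRow M i (λ b → c zero * V zero b + rest b))
    ≡⟨ det-setRow-+ M i (λ b → c zero * V zero b) rest ⟩
  det (setRow M i (λ b → c zero * V zero b)) + det (setRow M i rest)
    ≡⟨ cong₂ _+_ (det-setRow-* M i (c zero) (V zero)) (det-setRow-sumFin K M i (λ l → c (suc l)) (λ l → V (suc l))) ⟩
  c zero * det (setRow M i (V zero)) + sumFin (λ l → c (suc l) * det (setRow M i (V (suc l)))) ∎
  where open ≡-Reasoning
        rest : Fin k → ℤ
        rest b = sumFin (λ l → c (suc l) * V (suc l) b)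

det-addRowCombination : ∀ {k} (M : Matrix k) (i : Fin k) (c : Fin k → ℤ) → c i ≡ + 0 →
  det (setRow M i (λ b → M i b + sumFin (λ l → c l * M l b))) ≡ det M
det-addRowCombination {k} M i c cᵢ≡0 = begin
  det (setRow M i (λ b → M i b + sumFin (λ l → c l * M l b)))
    ≡⟨ det-setRow-+ M i (M i) _ ⟩
  det (setRow M i (M i)) + det (setRow M i (λ b → sumFin (λ l → c l * M l b)))
    ≡⟨ cong₂ _+_ (det-cong unchanged) (det-setRow-sumFin k M i c M) ⟩
  det M + sumFin (λ l → c l * det (setRow M i (M l)))
    ≡⟨ cong (_+_ (det M)) (sumFin-zero _ vanishing) ⟩
  det M + + 0
    ≡⟨ ℤ.+-identityʳ (det M) ⟩
  det M ∎
  where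
    open ≡-Reasoning
    unchanged : ∀ a b → setRow M i (M i) a b ≡ M a b
    unchanged a b with a ≟ i
    ... | yes refl = refl
    ... | no _ = refl
    vanishing : ∀ l → c l * det (setRow M i (M l)) ≡ + 0
    vanishing l with i ≟ l
    ... | yes refl = cong (_* det (setRow M i (M i))) cᵢ≡0
    ... | no i≢l = trans (cong (c l *_) (det-equalRows (setRow M i (M l)) i l i≢l
                     (λ b → trans (setRow-≡ M i (M l) b) (sym (setRow-≢ M i (M l) b (λ l≡i → i≢l (sym l≡i)))))))
                   (ℤ.*-zeroʳ (c l))

<ᵇ-suc-≢ : ∀ x t → ¬ x ≡ t → (x N.<ᵇ suc t) ≡ (x N.<ᵇ t)
<ᵇ-suc-≢ zero    zero    x≢t = ⊥-elim (x≢t refl)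
<ᵇ-suc-≢ zero    (suc t) _   = refl
<ᵇ-suc-≢ (suc zero)    zero    _ = refl
<ᵇ-suc-≢ (suc (suc x)) zero    _ = refl
<ᵇ-suc-≢ (suc x) (suc t) x≢t = <ᵇ-suc-≢ x t (λ x≡t → x≢t (cong suc x≡t))

<ᵇ-suc-self : ∀ t → (t N.<ᵇ suc t) ≡ true
<ᵇ-suc-self zero    = refl
<ᵇ-suc-self (suc t) = <ᵇ-suc-self t

<ᵇ-self : ∀ t → (t N.<ᵇ t) ≡ false
<ᵇ-self zero    = refl
<ᵇ-self (suc t) = <ᵇ-self t

<⇒<ᵇ≡true : ∀ x t → x N.< t → (x N.<ᵇ t) ≡ true
<⇒<ᵇ≡true zero    (suc t) _         = refl
<⇒<ᵇ≡true (suc x) (suc t) (s≤s x<t) = <⇒<ᵇ≡true x t x<t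

-- Rows outside `source` get combinations of rows in `source`, which themselves stay fixed;
-- the rows are updated one at a time.
det-addSourceCombinations : ∀ {k} (M N : Matrix k) (source : Fin k → Bool) (c : Fin k → Fin k → ℤ) →
  (∀ a l → source l ≡ false → c a l ≡ + 0) → (∀ a l → source a ≡ true → c a l ≡ + 0) →
  (∀ a b → N a b ≡ M a b + sumFin (λ l → c a l * M l b)) → det N ≡ det M
det-addSourceCombinations {k} M N source c only-sources sources-fixed N≗ =
  trans (det-cong N≗partial) (det-partial k)
  where
    partial : ℕ → Matrix k
    partial t a b = if toℕ a N.<ᵇ t then N a b else M a b

    N-source : ∀ l b → source l ≡ true → N l b ≡ M l b
    N-source l b src = trans (N≗ l b) (trans
      (cong (_+_ (M l b)) (sumFin-zero _ (λ l′ → cong (_* M l′ b) (sources-fixed l l′ src))))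
      (ℤ.+-identityʳ (M l b)))

    partial-combination : ∀ t a l b → c a l * partial t l b ≡ c a l * M l b
    partial-combination t a l b with source l in src
    ... | false = trans (cong (_* partial t l b) (only-sources a l src))
                        (sym (cong (_* M l b) (only-sources a l src)))
    ... | true with toℕ l N.<ᵇ t
    ...   | true  = cong (c a l *_) (N-source l b src)
    ...   | false = refl

    N≗partial : ∀ a b → N a b ≡ partial k a b
    N≗partial a b rewrite <⇒<ᵇ≡true (toℕ a) k (toℕ<n a) = refl

    det-partial-step : ∀ t → det (partial (suc t)) ≡ det (partial t)
    det-partial-step t with t N.<? k
    ... | no t≮k = det-cong (λ a b → cong (λ x → if x then N a b else M a b)
                     (<ᵇ-suc-≢ (toℕ a) t (λ a≡t → t≮k (subst (N._< k) a≡t (toℕ<n a)))))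
    ... | yes t<k = trans (det-cong updatesRow-t) (det-addRowCombination (partial t) row-t (c row-t) c-diagonal)
      where
        row-t : Fin k
        row-t = fromℕ< t<k
        c-diagonal : c row-t row-t ≡ + 0
        c-diagonal with source row-t in src
        ... | true  = sources-fixed row-t row-t src
        ... | false = only-sources row-t row-t src
        updatesRow-t : ∀ a b → partial (suc t) a b
          ≡ setRow (partial t) row-t (λ b → partial t row-t b + sumFin (λ l → c row-t l * partial t l b)) a b
        updatesRow-t a b with toℕ a N.≟ t
        ... | no a≢t rewrite <ᵇ-suc-≢ (toℕ a) t a≢t
                          | eqᵇ-≢ {i = a} {row-t} (λ a≡t → a≢t (trans (cong toℕ a≡t) (toℕ-fromℕ< t<k))) = refl
        ... | yes a≡t with toℕ-injective (trans a≡t (sym (toℕ-fromℕ< t<k)))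
        ...   | refl rewrite eqᵇ-refl a | a≡t | <ᵇ-suc-self t | <ᵇ-self t =
                trans (N≗ a b) (cong (_+_ (M a b)) (sumFin-cong (λ l → sym (partial-combination t a l b))))

    det-partial : ∀ t → det (partial t) ≡ det M
    det-partial zero    = refl
    det-partial (suc t) = trans (det-partial-step t) (det-partial t)

toℕ-punchIn-< : ∀ {k} (j : Fin (suc k)) (b : Fin k) → toℕ b N.< toℕ j → toℕ (punchIn j b) ≡ toℕ b
toℕ-punchIn-< (suc j) zero    _         = refl
toℕ-punchIn-< (suc j) (suc b) (s≤s b<j) = cong suc (toℕ-punchIn-< j b b<j)

toℕ-punchIn-≥ : ∀ {k} (j : Fin (suc k)) (b : Fin k) → toℕ j N.≤ toℕ b → toℕ (punchIn j b) ≡ suc (toℕ b)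
toℕ-punchIn-≥ zero    b       _         = refl
toℕ-punchIn-≥ (suc j) (suc b) (s≤s j≤b) = cong suc (toℕ-punchIn-≥ j b j≤b)

toℕ-punchIn-≤ : ∀ {k} (j : Fin (suc k)) (b : Fin k) → toℕ (punchIn j b) N.≤ suc (toℕ b)
toℕ-punchIn-≤ zero    b       = N.≤-refl
toℕ-punchIn-≤ (suc j) zero    = z≤n
toℕ-punchIn-≤ (suc j) (suc b) = s≤s (toℕ-punchIn-≤ j b)

-- The last k ∸ p rows are supported on the last k ∸ q < k ∸ p columns.
det-zeroBlock : ∀ {k} p q (M : Matrix k) → p N.< q → q N.≤ k →
  (∀ i j → p N.≤ toℕ i → toℕ j N.< q → M i j ≡ + 0) → det M ≡ + 0
det-zeroBlock {zero}  p zero    M () _  _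
det-zeroBlock {zero}  p (suc q) M _  () _
det-zeroBlock {suc k} zero q M p<q q≤k zeros = sumFin-zero (laplaceTerm M) term
  where
    term : ∀ j → laplaceTerm M j ≡ + 0
    term j with toℕ j N.<? q
    ... | yes j<q = trans (cong (λ x → sign j * x * det (minor M j)) (zeros zero j z≤n j<q))
                          (cong (_* det (minor M j)) (ℤ.*-zeroʳ (sign j)))
    ... | no j≮q = trans (cong (sign j * M zero j *_)
                    (det-zeroBlock zero q (minor M j) p<q (N.≤-trans (N.≮⇒≥ j≮q) (N.≤-pred (toℕ<n j)))
                      (λ a b _ b<q → zeros (suc a) (punchIn j b) z≤n
                        (subst (N._< q) (sym (toℕ-punchIn-< j b (N.<-≤-trans b<q (N.≮⇒≥ j≮q)))) b<q))))
                   (ℤ.*-zeroʳ (sign j * M zero j))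
det-zeroBlock {suc k} (suc p) (suc q) M (s≤s p<q) (s≤s q≤k) zeros = sumFin-zero (laplaceTerm M) (λ j →
  trans (cong (sign j * M zero j *_) (det-zeroBlock p q (minor M j) p<q q≤k
          (λ a b p≤a b<q → zeros (suc a) (punchIn j b) (s≤s p≤a) (N.≤-<-trans (toℕ-punchIn-≤ j b) (s≤s b<q)))))
        (ℤ.*-zeroʳ (sign j * M zero j)))

topLeft : ∀ n m → Matrix (n N.+ m) → Matrix n
topLeft n m M i j = M (i ↑ˡ m) (j ↑ˡ m)

bottomRight : ∀ n m → Matrix (n N.+ m) → Matrix m
bottomRight n m M i j = M (n ↑ʳ i) (n ↑ʳ j)

punchIn-↑ˡ-↑ʳ : ∀ {n m} (i : Fin (suc n)) (j : Fin m) → punchIn (i ↑ˡ m) (n ↑ʳ j) ≡ suc (n ↑ʳ j)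
punchIn-↑ˡ-↑ʳ zero    j = refl
punchIn-↑ˡ-↑ʳ {suc n} (suc i) j = cong suc (punchIn-↑ˡ-↑ʳ i j)

punchIn-↑ˡ-↑ˡ : ∀ {n m} (i : Fin (suc n)) (j : Fin n) → punchIn (i ↑ˡ m) (j ↑ˡ m) ≡ punchIn i j ↑ˡ m
punchIn-↑ˡ-↑ˡ zero    j       = refl
punchIn-↑ˡ-↑ˡ (suc i) zero    = refl
punchIn-↑ˡ-↑ˡ (suc i) (suc j) = cong suc (punchIn-↑ˡ-↑ˡ i j)

toℕ-↑ʳ-≥ : ∀ n {m} (e : Fin m) → n N.≤ toℕ (n ↑ʳ e)
toℕ-↑ʳ-≥ n e = subst (n N.≤_) (sym (toℕ-↑ʳ n e)) (N.m≤m+n n (toℕ e))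

toℕ-↑ˡ-< : ∀ {n} (v : Fin n) m → toℕ (v ↑ˡ m) N.< n
toℕ-↑ˡ-< v m = subst (N._< _) (sym (toℕ-↑ˡ v m)) (toℕ<n v)

det-blockExpansion : ∀ n m (M : Matrix (suc n N.+ m)) →
  (∀ i → det (minor M (i ↑ˡ m)) ≡ det (minor (topLeft (suc n) m M) i) * det (bottomRight (suc n) m M)) →
  (∀ e → laplaceTerm M (suc n ↑ʳ e) ≡ + 0) →
  det M ≡ det (topLeft (suc n) m M) * det (bottomRight (suc n) m M)
det-blockExpansion n m M minorsFactor rightTermsVanish = begin
  det M
    ≡⟨ sumFin-splitAt (suc n) m (laplaceTerm M) ⟩
  sumFin (λ i → laplaceTerm M (i ↑ˡ m)) + sumFin (λ e → laplaceTerm M (suc n ↑ʳ e))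
    ≡⟨ cong₂ _+_ (sumFin-cong (λ i → cong₂ (λ s d → s * M zero (i ↑ˡ m) * d)
                                            (cong ((- + 1) ^_) (toℕ-↑ˡ i m)) (minorsFactor i)))
                 (sumFin-zero _ rightTermsVanish) ⟩
  sumFin (λ i → sign i * A zero i * (det (minor A i) * det D)) + + 0
    ≡⟨ ℤ.+-identityʳ _ ⟩
  sumFin (λ i → sign i * A zero i * (det (minor A i) * det D))
    ≡⟨ sumFin-cong (λ i → sym (ℤ.*-assoc (sign i * A zero i) (det (minor A i)) (det D))) ⟩
  sumFin (λ i → laplaceTerm A i * det D)
    ≡⟨ sumFin-*ʳ (det D) (laplaceTerm A) ⟩
  det A * det D ∎
  where open ≡-Reasoning
        A : Matrix (suc n)
        A = topLeft (suc n) m M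
        D : Matrix m
        D = bottomRight (suc n) m M

det-lowerBlockTriangular : ∀ n m (M : Matrix (n N.+ m)) →
  (∀ i j → toℕ i N.< n → n N.≤ toℕ j → M i j ≡ + 0) →
  det M ≡ det (topLeft n m M) * det (bottomRight n m M)
det-lowerBlockTriangular zero    m M _ = sym (ℤ.*-identityˡ (det M))
det-lowerBlockTriangular (suc n) m M zeros = det-blockExpansion n m M minorsFactor rightTermsVanish
  where
    minorsFactor : ∀ i → det (minor M (i ↑ˡ m)) ≡ det (minor (topLeft (suc n) m M) i) * det (bottomRight (suc n) m M)
    minorsFactor i = trans
      (det-lowerBlockTriangular n m (minor M (i ↑ˡ m)) (λ a b a<n n≤b →
        zeros (suc a) (punchIn (i ↑ˡ m) b) (s≤s a<n)
          (subst (suc n N.≤_) (sym (toℕ-punchIn-≥ (i ↑ˡ m) b (N.≤-trans (N.≤-pred (toℕ-↑ˡ-< i m)) n≤b))) (s≤s n≤b))))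
      (cong₂ _*_ (det-cong (λ a b → cong (M (suc (a ↑ˡ m))) (punchIn-↑ˡ-↑ˡ i b)))
                 (det-cong (λ a b → cong (M (suc (n ↑ʳ a))) (punchIn-↑ˡ-↑ʳ i b))))
    rightTermsVanish : ∀ e → laplaceTerm M (suc n ↑ʳ e) ≡ + 0
    rightTermsVanish e = trans (cong (λ x → sign (suc n ↑ʳ e) * x * det (minor M (suc n ↑ʳ e)))
                                     (zeros zero (suc n ↑ʳ e) (s≤s z≤n) (toℕ-↑ʳ-≥ (suc n) e)))
                               (cong (_* det (minor M (suc n ↑ʳ e))) (ℤ.*-zeroʳ (sign (suc n ↑ʳ e))))

det-upperBlockTriangular : ∀ n m (M : Matrix (n N.+ m)) →
  (∀ i j → n N.≤ toℕ i → toℕ j N.< n → M i j ≡ + 0) →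
  det M ≡ det (topLeft n m M) * det (bottomRight n m M)
det-upperBlockTriangular zero    m M _ = sym (ℤ.*-identityˡ (det M))
det-upperBlockTriangular (suc n) m M zeros = det-blockExpansion n m M minorsFactor rightTermsVanish
  where
    minorsFactor : ∀ i → det (minor M (i ↑ˡ m)) ≡ det (minor (topLeft (suc n) m M) i) * det (bottomRight (suc n) m M)
    minorsFactor i = trans
      (det-upperBlockTriangular n m (minor M (i ↑ˡ m)) (λ a b n≤a b<n →
        zeros (suc a) (punchIn (i ↑ˡ m) b) (s≤s n≤a) (N.≤-<-trans (toℕ-punchIn-≤ (i ↑ˡ m) b) (s≤s b<n))))
      (cong₂ _*_ (det-cong (λ a b → cong (M (suc (a ↑ˡ m))) (punchIn-↑ˡ-↑ˡ i b)))
                 (det-cong (λ a b → cong (M (suc (n ↑ʳ a))) (punchIn-↑ˡ-↑ʳ i b))))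
    -- the minor keeps the m × (n + 1) zero block below the first n rows
    rightTermsVanish : ∀ e → laplaceTerm M (suc n ↑ʳ e) ≡ + 0
    rightTermsVanish e = trans (cong (sign (suc n ↑ʳ e) * M zero (suc n ↑ʳ e) *_)
      (det-zeroBlock n (suc n) (minor M (suc n ↑ʳ e)) N.≤-refl
        (subst (N._≤ n N.+ m) (N.+-comm n 1) (N.+-monoʳ-≤ n (1≤m e)))
        (λ a b n≤a b<sn → zeros (suc a) (punchIn (suc n ↑ʳ e) b) (s≤s n≤a)
          (subst (N._< suc n) (sym (toℕ-punchIn-< (suc n ↑ʳ e) b (N.<-≤-trans b<sn (toℕ-↑ʳ-≥ (suc n) e)))) b<sn))))
      (ℤ.*-zeroʳ (sign (suc n ↑ʳ e) * M zero (suc n ↑ʳ e)))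
      where 1≤m : Fin m → 1 N.≤ m
            1≤m zero    = s≤s z≤n
            1≤m (suc _) = s≤s z≤n

Mat : ℕ → ℕ → Set
Mat p q = Fin p → Fin q → ℤ

module Blocks (n m : ℕ) where

  _++ᵣ_ : (Fin n → ℤ) → (Fin m → ℤ) → Fin (n N.+ m) → ℤ
  (u ++ᵣ w) j = [ u , w ]′ (splitAt n j)

  blk : Mat n n → Mat n m → Mat m n → Mat m m → Matrix (n N.+ m)
  blk TL TR BL BR i = [ (λ v → TL v ++ᵣ TR v) , (λ e → BL e ++ᵣ BR e) ]′ (splitAt n i)

  ++ᵣ-↑ˡ : ∀ u w v → (u ++ᵣ w) (v ↑ˡ m) ≡ u v
  ++ᵣ-↑ˡ u w v rewrite splitAt-↑ˡ n v m = refl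

  ++ᵣ-↑ʳ : ∀ u w e → (u ++ᵣ w) (n ↑ʳ e) ≡ w e
  ++ᵣ-↑ʳ u w e rewrite splitAt-↑ʳ n m e = refl

  module _ {TL : Mat n n} {TR : Mat n m} {BL : Mat m n} {BR : Mat m m} where

    blk-↑ˡ : ∀ v j → blk TL TR BL BR (v ↑ˡ m) j ≡ (TL v ++ᵣ TR v) j
    blk-↑ˡ v j rewrite splitAt-↑ˡ n v m = refl

    blk-↑ʳ : ∀ e j → blk TL TR BL BR (n ↑ʳ e) j ≡ (BL e ++ᵣ BR e) j
    blk-↑ʳ e j rewrite splitAt-↑ʳ n m e = refl

    blk-↑ˡ-↑ˡ : ∀ v w → blk TL TR BL BR (v ↑ˡ m) (w ↑ˡ m) ≡ TL v w
    blk-↑ˡ-↑ˡ v w = trans (blk-↑ˡ v (w ↑ˡ m)) (++ᵣ-↑ˡ (TL v) (TR v) w)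

    blk-↑ˡ-↑ʳ : ∀ v f → blk TL TR BL BR (v ↑ˡ m) (n ↑ʳ f) ≡ TR v f
    blk-↑ˡ-↑ʳ v f = trans (blk-↑ˡ v (n ↑ʳ f)) (++ᵣ-↑ʳ (TL v) (TR v) f)

    blk-↑ʳ-↑ˡ : ∀ e w → blk TL TR BL BR (n ↑ʳ e) (w ↑ˡ m) ≡ BL e w
    blk-↑ʳ-↑ˡ e w = trans (blk-↑ʳ e (w ↑ˡ m)) (++ᵣ-↑ˡ (BL e) (BR e) w)

    blk-↑ʳ-↑ʳ : ∀ e f → blk TL TR BL BR (n ↑ʳ e) (n ↑ʳ f) ≡ BR e f
    blk-↑ʳ-↑ʳ e f = trans (blk-↑ʳ e (n ↑ʳ f)) (++ᵣ-↑ʳ (BL e) (BR e) f)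

  ↑ˡ≢↑ʳ : ∀ (v : Fin n) (e : Fin m) → ¬ v ↑ˡ m ≡ n ↑ʳ e
  ↑ˡ≢↑ʳ v e v≡e = N.<⇒≱ (toℕ-↑ˡ-< v m) (subst (λ i → n N.≤ toℕ i) (sym v≡e) (toℕ-↑ʳ-≥ n e))

  δ-↑ˡ-↑ˡ : ∀ (v w : Fin n) → δ (v ↑ˡ m) (w ↑ˡ m) ≡ δ v w
  δ-↑ˡ-↑ˡ v w with v ≟ w
  ... | yes refl = cong ind (eqᵇ-refl (v ↑ˡ m))
  ... | no v≢w  = cong ind (eqᵇ-≢ (λ eq → v≢w (↑ˡ-injective m v w eq)))

  δ-↑ʳ-↑ʳ : ∀ (e f : Fin m) → δ (n ↑ʳ e) (n ↑ʳ f) ≡ δ e f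
  δ-↑ʳ-↑ʳ e f with e ≟ f
  ... | yes refl = cong ind (eqᵇ-refl (n ↑ʳ e))
  ... | no e≢f  = cong ind (eqᵇ-≢ (λ eq → e≢f (↑ʳ-injective n e f eq)))

  δ-↑ˡ-↑ʳ : ∀ (v : Fin n) (f : Fin m) → δ (v ↑ˡ m) (n ↑ʳ f) ≡ + 0
  δ-↑ˡ-↑ʳ v f = cong ind (eqᵇ-≢ (↑ˡ≢↑ʳ v f))

  δ-↑ʳ-↑ˡ : ∀ (e : Fin m) (w : Fin n) → δ (n ↑ʳ e) (w ↑ˡ m) ≡ + 0
  δ-↑ʳ-↑ˡ e w = cong ind (eqᵇ-≢ (λ eq → ↑ˡ≢↑ʳ w e (sym eq)))

  ↑-elim : ∀ {ℓ} (P : Fin (n N.+ m) → Set ℓ) → (∀ v → P (v ↑ˡ m)) → (∀ e → P (n ↑ʳ e)) → ∀ i → P i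
  ↑-elim P top bottom i with splitAt n i in eq
  ... | inj₁ v = subst P (splitAt⁻¹-↑ˡ eq) (top v)
  ... | inj₂ e = subst P (splitAt⁻¹-↑ʳ eq) (bottom e)

  ≗-blk : (M : Matrix (n N.+ m)) {TL : Mat n n} {TR : Mat n m} {BL : Mat m n} {BR : Mat m m} →
    (∀ v w → M (v ↑ˡ m) (w ↑ˡ m) ≡ TL v w) → (∀ v f → M (v ↑ˡ m) (n ↑ʳ f) ≡ TR v f) →
    (∀ e w → M (n ↑ʳ e) (w ↑ˡ m) ≡ BL e w) → (∀ e f → M (n ↑ʳ e) (n ↑ʳ f) ≡ BR e f) →
    ∀ i j → M i j ≡ blk TL TR BL BR i j
  ≗-blk M M₁₁ M₁₂ M₂₁ M₂₂ = ↑-elim _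
    (λ v → ↑-elim _ (λ w → trans (M₁₁ v w) (sym (blk-↑ˡ-↑ˡ v w))) (λ f → trans (M₁₂ v f) (sym (blk-↑ˡ-↑ʳ v f))))
    (λ e → ↑-elim _ (λ w → trans (M₂₁ e w) (sym (blk-↑ʳ-↑ˡ e w))) (λ f → trans (M₂₂ e f) (sym (blk-↑ʳ-↑ʳ e f))))

  det-blk-cong : ∀ {TL TL′ TR TR′ BL BL′ BR BR′} →
    (∀ v w → TL v w ≡ TL′ v w) → (∀ v f → TR v f ≡ TR′ v f) →
    (∀ e w → BL e w ≡ BL′ e w) → (∀ e f → BR e f ≡ BR′ e f) →
    det (blk TL TR BL BR) ≡ det (blk TL′ TR′ BL′ BR′)
  det-blk-cong TL≗ TR≗ BL≗ BR≗ = det-cong (≗-blk _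
    (λ v w → trans (blk-↑ˡ-↑ˡ v w) (TL≗ v w)) (λ v f → trans (blk-↑ˡ-↑ʳ v f) (TR≗ v f))
    (λ e w → trans (blk-↑ʳ-↑ˡ e w) (BL≗ e w)) (λ e f → trans (blk-↑ʳ-↑ʳ e f) (BR≗ e f)))

  det-blk-lower : ∀ TL BL BR → det (blk TL (λ _ _ → + 0) BL BR) ≡ det TL * det BR
  det-blk-lower TL BL BR = trans (det-lowerBlockTriangular n m _ zeros)
    (cong₂ _*_ (det-cong blk-↑ˡ-↑ˡ) (det-cong blk-↑ʳ-↑ʳ))
    where zeros : ∀ i j → toℕ i N.< n → n N.≤ toℕ j → blk TL (λ _ _ → + 0) BL BR i j ≡ + 0
          zeros i j i<n n≤j rewrite splitAt-< n i i<n | splitAt-≥ n j n≤j = refl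

  det-blk-upper : ∀ TL TR BR → det (blk TL TR (λ _ _ → + 0) BR) ≡ det TL * det BR
  det-blk-upper TL TR BR = trans (det-upperBlockTriangular n m _ zeros)
    (cong₂ _*_ (det-cong blk-↑ˡ-↑ˡ) (det-cong blk-↑ʳ-↑ʳ))
    where zeros : ∀ i j → n N.≤ toℕ i → toℕ j N.< n → blk TL TR (λ _ _ → + 0) BR i j ≡ + 0
          zeros i j n≤i j<n rewrite splitAt-≥ n i n≤i | splitAt-< n j j<n = refl

  ++ᵣ-+-combination : ∀ {K} (x : Fin n → ℤ) (y : Fin m → ℤ) (c : Fin K → ℤ) (X : Mat K n) (Y : Mat K m) j →
    ((λ w → x w + sumFin (λ u → c u * X u w)) ++ᵣ (λ f → y f + sumFin (λ u → c u * Y u f))) j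
      ≡ (x ++ᵣ y) j + sumFin (λ u → c u * (X u ++ᵣ Y u) j)
  ++ᵣ-+-combination x y c X Y j with splitAt n j
  ... | inj₁ _ = refl
  ... | inj₂ _ = refl

  sumFin-++ᵣ : ∀ (c : Fin n → ℤ) (d : Fin m → ℤ) (X : Fin (n N.+ m) → ℤ) →
    sumFin (λ l → (c ++ᵣ d) l * X l) ≡ sumFin (λ u → c u * X (u ↑ˡ m)) + sumFin (λ g → d g * X (n ↑ʳ g))
  sumFin-++ᵣ c d X = trans (sumFin-splitAt n m (λ l → (c ++ᵣ d) l * X l))
    (cong₂ _+_ (sumFin-cong (λ u → cong (_* X (u ↑ˡ m)) (++ᵣ-↑ˡ c d u)))
               (sumFin-cong (λ g → cong (_* X (n ↑ʳ g)) (++ᵣ-↑ʳ c d g))))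

  sumFin-zero-* : ∀ {K} (X : Fin K → ℤ) → sumFin (λ u → + 0 * X u) ≡ + 0
  sumFin-zero-* X = sumFin-zero (λ u → + 0 * X u) (λ _ → refl)

  isTop : Fin (n N.+ m) → Bool
  isTop i = [ (λ _ → true) , (λ _ → false) ]′ (splitAt n i)

  isTop-↑ˡ : ∀ v → isTop (v ↑ˡ m) ≡ true
  isTop-↑ˡ v rewrite splitAt-↑ˡ n v m = refl

  isTop-↑ʳ : ∀ e → isTop (n ↑ʳ e) ≡ false
  isTop-↑ʳ e rewrite splitAt-↑ʳ n m e = refl

  det-blk-addTopToBottom : ∀ TL TR BL BR (c : Mat m n) →
    det (blk TL TR (λ e w → BL e w + sumFin (λ u → c e u * TL u w)) (λ e f → BR e f + sumFin (λ u → c e u * TR u f)))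
      ≡ det (blk TL TR BL BR)
  det-blk-addTopToBottom TL TR BL BR c =
    det-addSourceCombinations M N isTop coeff fromTopOnly topFixed (↑-elim _ top bottom)
    where
      open ≡-Reasoning
      M N coeff : Matrix (n N.+ m)
      M = blk TL TR BL BR
      N = blk TL TR (λ e w → BL e w + sumFin (λ u → c e u * TL u w)) (λ e f → BR e f + sumFin (λ u → c e u * TR u f))
      O : ∀ {p q} → Mat p q
      O _ _ = + 0
      coeff = blk O O c O
      fromTopOnly : ∀ a l → isTop l ≡ false → coeff a l ≡ + 0
      fromTopOnly a = ↑-elim _
        (λ v top≡false → ⊥-elim (true≢false (trans (sym (isTop-↑ˡ v)) top≡false)))
        (λ g _ → ↑-elim (λ a → coeff a (n ↑ʳ g) ≡ + 0) (λ v → blk-↑ˡ-↑ʳ v g) (λ e → blk-↑ʳ-↑ʳ e g) a)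
      topFixed : ∀ a l → isTop a ≡ true → coeff a l ≡ + 0
      topFixed a l = ↑-elim (λ a → isTop a ≡ true → coeff a l ≡ + 0)
        (λ v _ → ↑-elim (λ l → coeff (v ↑ˡ m) l ≡ + 0) (blk-↑ˡ-↑ˡ v) (blk-↑ˡ-↑ʳ v) l)
        (λ e bottom≡true → ⊥-elim (true≢false (trans (sym bottom≡true) (isTop-↑ʳ e)))) a
      top : ∀ v b → N (v ↑ˡ m) b ≡ M (v ↑ˡ m) b + sumFin (λ l → coeff (v ↑ˡ m) l * M l b)
      top v b = begin
        N (v ↑ˡ m) b                                           ≡⟨ trans (blk-↑ˡ v b) (sym (blk-↑ˡ v b)) ⟩
        M (v ↑ˡ m) b                                           ≡⟨ sym (ℤ.+-identityʳ _) ⟩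
        M (v ↑ˡ m) b + + 0                                     ≡⟨ cong (_+_ (M (v ↑ˡ m) b)) (sym (sumFin-zero _
                                                                    (λ l → cong (_* M l b) (topFixed (v ↑ˡ m) l (isTop-↑ˡ v))))) ⟩
        M (v ↑ˡ m) b + sumFin (λ l → coeff (v ↑ˡ m) l * M l b) ∎
      bottom : ∀ e b → N (n ↑ʳ e) b ≡ M (n ↑ʳ e) b + sumFin (λ l → coeff (n ↑ʳ e) l * M l b)
      bottom e b = begin
        N (n ↑ʳ e) b
          ≡⟨ blk-↑ʳ e b ⟩
        ((λ w → BL e w + sumFin (λ u → c e u * TL u w)) ++ᵣ (λ f → BR e f + sumFin (λ u → c e u * TR u f))) b
          ≡⟨ ++ᵣ-+-combination (BL e) (BR e) (c e) TL TR b ⟩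
        (BL e ++ᵣ BR e) b + sumFin (λ u → c e u * (TL u ++ᵣ TR u) b)
          ≡⟨ cong₂ _+_ (sym (blk-↑ʳ e b)) (sumFin-cong (λ u → cong (c e u *_) (sym (blk-↑ˡ u b)))) ⟩
        M (n ↑ʳ e) b + sumFin (λ u → c e u * M (u ↑ˡ m) b)
          ≡⟨ cong (_+_ (M (n ↑ʳ e) b)) (sym (trans (sumFin-++ᵣ (c e) (O e) (λ l → M l b))
                                                  (trans (cong (_+_ (sumFin (λ u → c e u * M (u ↑ˡ m) b)))
                                                               (sumFin-zero-* (λ g → M (n ↑ʳ g) b)))
                                                         (ℤ.+-identityʳ _)))) ⟩
        M (n ↑ʳ e) b + sumFin (λ l → (c e ++ᵣ O e) l * M l b)
          ≡⟨ cong (_+_ (M (n ↑ʳ e) b)) (sumFin-cong (λ l → cong (_* M l b) (sym (blk-↑ʳ e l)))) ⟩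
        M (n ↑ʳ e) b + sumFin (λ l → coeff (n ↑ʳ e) l * M l b) ∎

  det-blk-addBottomToTop : ∀ TL TR BL BR (c : Mat n m) →
    det (blk (λ v w → TL v w + sumFin (λ g → c v g * BL g w)) (λ v f → TR v f + sumFin (λ g → c v g * BR g f)) BL BR)
      ≡ det (blk TL TR BL BR)
  det-blk-addBottomToTop TL TR BL BR c =
    det-addSourceCombinations M N isBottom coeff fromBottomOnly bottomFixed (↑-elim _ top bottom)
    where
      open ≡-Reasoning
      M N coeff : Matrix (n N.+ m)
      M = blk TL TR BL BR
      N = blk (λ v w → TL v w + sumFin (λ g → c v g * BL g w)) (λ v f → TR v f + sumFin (λ g → c v g * BR g f)) BL BR
      O : ∀ {p q} → Mat p q
      O _ _ = + 0
      coeff = blk O c O O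
      isBottom : Fin (n N.+ m) → Bool
      isBottom i = not (isTop i)
      fromBottomOnly : ∀ a l → isBottom l ≡ false → coeff a l ≡ + 0
      fromBottomOnly a = ↑-elim _
        (λ u _ → ↑-elim (λ a → coeff a (u ↑ˡ m) ≡ + 0) (λ v → blk-↑ˡ-↑ˡ v u) (λ e → blk-↑ʳ-↑ˡ e u) a)
        (λ g bottom≡false → ⊥-elim (true≢false (trans (sym (cong not (isTop-↑ʳ g))) bottom≡false)))
      bottomFixed : ∀ a l → isBottom a ≡ true → coeff a l ≡ + 0
      bottomFixed a l = ↑-elim (λ a → isBottom a ≡ true → coeff a l ≡ + 0)
        (λ v top≡true → ⊥-elim (true≢false (trans (sym top≡true) (cong not (isTop-↑ˡ v)))))
        (λ e _ → ↑-elim (λ l → coeff (n ↑ʳ e) l ≡ + 0) (blk-↑ʳ-↑ˡ e) (blk-↑ʳ-↑ʳ e) l) a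
      top : ∀ v b → N (v ↑ˡ m) b ≡ M (v ↑ˡ m) b + sumFin (λ l → coeff (v ↑ˡ m) l * M l b)
      top v b = begin
        N (v ↑ˡ m) b
          ≡⟨ blk-↑ˡ v b ⟩
        ((λ w → TL v w + sumFin (λ g → c v g * BL g w)) ++ᵣ (λ f → TR v f + sumFin (λ g → c v g * BR g f))) b
          ≡⟨ ++ᵣ-+-combination (TL v) (TR v) (c v) BL BR b ⟩
        (TL v ++ᵣ TR v) b + sumFin (λ g → c v g * (BL g ++ᵣ BR g) b)
          ≡⟨ cong₂ _+_ (sym (blk-↑ˡ v b)) (sumFin-cong (λ g → cong (c v g *_) (sym (blk-↑ʳ g b)))) ⟩
        M (v ↑ˡ m) b + sumFin (λ g → c v g * M (n ↑ʳ g) b)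
          ≡⟨ cong (_+_ (M (v ↑ˡ m) b)) (sym (trans (sumFin-++ᵣ (O v) (c v) (λ l → M l b))
                                                  (trans (cong (_+ sumFin (λ g → c v g * M (n ↑ʳ g) b))
                                                               (sumFin-zero-* (λ u → M (u ↑ˡ m) b)))
                                                         (ℤ.+-identityˡ _)))) ⟩
        M (v ↑ˡ m) b + sumFin (λ l → (O v ++ᵣ c v) l * M l b)
          ≡⟨ cong (_+_ (M (v ↑ˡ m) b)) (sumFin-cong (λ l → cong (_* M l b) (sym (blk-↑ˡ v l)))) ⟩
        M (v ↑ˡ m) b + sumFin (λ l → coeff (v ↑ˡ m) l * M l b) ∎
      bottom : ∀ e b → N (n ↑ʳ e) b ≡ M (n ↑ʳ e) b + sumFin (λ l → coeff (n ↑ʳ e) l * M l b)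
      bottom e b = begin
        N (n ↑ʳ e) b                                           ≡⟨ trans (blk-↑ʳ e b) (sym (blk-↑ʳ e b)) ⟩
        M (n ↑ʳ e) b                                           ≡⟨ sym (ℤ.+-identityʳ _) ⟩
        M (n ↑ʳ e) b + + 0                                     ≡⟨ cong (_+_ (M (n ↑ʳ e) b)) (sym (sumFin-zero _
                                                                    (λ l → cong (_* M l b) (bottomFixed (n ↑ʳ e) l
                                                                              (cong not (isTop-↑ʳ e)))))) ⟩
        M (n ↑ʳ e) b + sumFin (λ l → coeff (n ↑ʳ e) l * M l b) ∎

  det-blk-scaleBottom : ∀ TL TR BL BR (s : ℤ) →
    det (blk TL TR (λ e w → s * BL e w) (λ e f → s * BR e f)) ≡ s ^ m * det (blk TL TR BL BR)
  det-blk-scaleBottom TL TR BL BR s = begin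
    det (blk TL TR (λ e w → s * BL e w) (λ e f → s * BR e f))
      ≡⟨ det-cong (λ a b → sym (≗-blk (λ a b → weight a * M a b)
           (λ v w → trans (cong₂ _*_ (++ᵣ-↑ˡ _ _ v) (blk-↑ˡ-↑ˡ v w)) (ℤ.*-identityˡ (TL v w)))
           (λ v f → trans (cong₂ _*_ (++ᵣ-↑ˡ _ _ v) (blk-↑ˡ-↑ʳ v f)) (ℤ.*-identityˡ (TR v f)))
           (λ e w → cong₂ _*_ (++ᵣ-↑ʳ _ _ e) (blk-↑ʳ-↑ˡ e w))
           (λ e f → cong₂ _*_ (++ᵣ-↑ʳ _ _ e) (blk-↑ʳ-↑ʳ e f)) a b)) ⟩
    det (λ a b → weight a * M a b)
      ≡⟨ det-scaleRows weight M ⟩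
    prodFin weight * det M
      ≡⟨ cong (_* det M) weight-product ⟩
    s ^ m * det M ∎
    where
      open ≡-Reasoning
      M : Matrix (n N.+ m)
      M = blk TL TR BL BR
      weight : Fin (n N.+ m) → ℤ
      weight = (λ _ → + 1) ++ᵣ (λ _ → s)
      weight-product : prodFin weight ≡ s ^ m
      weight-product = begin
        prodFin weight
          ≡⟨ prodFin-splitAt n m weight ⟩
        prodFin (λ v → weight (v ↑ˡ m)) * prodFin (λ e → weight (n ↑ʳ e))
          ≡⟨ cong₂ _*_ (trans (prodFin-cong (++ᵣ-↑ˡ _ _)) (prodFin-const n (+ 1)))
                       (trans (prodFin-cong (++ᵣ-↑ʳ _ _)) (prodFin-const m s)) ⟩
        (+ 1) ^ n * s ^ m
          ≡⟨ trans (cong (_* s ^ m) (ℤ.^-zeroˡ n)) (ℤ.*-identityˡ (s ^ m)) ⟩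
        s ^ m ∎

module ConstantColumnSums {k} (Z : Matrix (suc k)) (λ₀ : ℤ) (colsum : ∀ f → sumFin (λ e → Z e f) ≡ λ₀) where

  ones : Fin (suc k) → ℤ
  ones _ = + 1

  -- Adding all rows to row 0 turns it into the constant λ₀ - t (k + 1), which then factors out;
  -- subtracting t times the new row 0 from the others removes the shift.
  det-subConst-rowOnes : ∀ t → det (λ e f → Z e f - t) ≡ (λ₀ - t * + suc k) * det (setRow Z zero ones)
  det-subConst-rowOnes t = begin
    det Y
      ≡⟨ sym (det-addRowCombination Y zero c refl) ⟩
    det (setRow Y zero (λ f → Y zero f + sumFin (λ l → c l * Y l f)))
      ≡⟨ det-cong (λ a f → cong (λ x → if eqᵇ a zero then x else Y a f) (row0-constant f)) ⟩
    det (setRow Y zero (λ _ → β * + 1))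
      ≡⟨ det-setRow-* Y zero β ones ⟩
    β * det (setRow Y zero ones)
      ≡⟨ cong (β *_) (sym (det-addSourceCombinations (setRow Y zero ones) (setRow Z zero ones) isZero shift
                             (λ { _ zero () ; zero (suc _) _ → refl ; (suc _) (suc _) _ → refl }) (λ { zero l _ → refl }) unshift)) ⟩
    β * det (setRow Z zero ones) ∎
    where
      open ≡-Reasoning
      Y : Matrix (suc k)
      Y e f = Z e f - t
      β : ℤ
      β = λ₀ - t * + suc k
      c : Fin (suc k) → ℤ
      c zero    = + 0
      c (suc _) = + 1
      row0-constant : ∀ f → Y zero f + sumFin (λ l → c l * Y l f) ≡ β * + 1
      row0-constant f = begin
        Y zero f + (+ 0 * Y zero f + sumFin (λ l → + 1 * Y (suc l) f))
          ≡⟨ cong (λ x → Y zero f + (+ 0 * Y zero f + x)) (sumFin-cong (λ l → ℤ.*-identityˡ (Y (suc l) f))) ⟩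
        Y zero f + (+ 0 * Y zero f + sumFin (λ l → Y (suc l) f))
          ≡⟨ cong (_+_ (Y zero f)) (ℤ.+-identityˡ _) ⟩
        sumFin (λ l → Z l f + - t)
          ≡⟨ sumFin-+ (λ l → Z l f) (λ _ → - t) ⟩
        sumFin (λ l → Z l f) + sumFin {suc k} (λ _ → - t)
          ≡⟨ cong₂ _+_ (colsum f) (sumFin-const (suc k) (- t)) ⟩
        λ₀ + + suc k * - t
          ≡⟨ rearrange λ₀ t (+ suc k) ⟩
        β * + 1 ∎
        where rearrange : ∀ x t n → x + n * - t ≡ (x - t * n) * + 1
              rearrange = solve-∀
      isZero : Fin (suc k) → Bool
      isZero zero    = true
      isZero (suc _) = false
      shift : Fin (suc k) → Fin (suc k) → ℤ
      shift (suc _) zero = t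
      shift _       _    = + 0
      unshift : ∀ a f → setRow Z zero ones a f ≡ setRow Y zero ones a f + sumFin (λ l → shift a l * setRow Y zero ones l f)
      unshift zero    f = sym (cong (_+_ (+ 1)) (sumFin-zero {suc k} _ (λ _ → refl)))
      unshift (suc a) f = sym (trans (cong (_+_ (Z (suc a) f - t)) (cong (_+_ (t * + 1)) (sumFin-zero {k} _ (λ _ → refl))))
                                     (cancel (Z (suc a) f) t))
        where cancel : ∀ z t → z - t + (t * + 1 + + 0) ≡ z
              cancel = solve-∀

  det-subConst : ∀ t → λ₀ * det (λ e f → Z e f - t) ≡ (λ₀ - t * + suc k) * det Z
  det-subConst t = begin
    λ₀ * det (λ e f → Z e f - t)                 ≡⟨ cong (λ₀ *_) (det-subConst-rowOnes t) ⟩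
    λ₀ * ((λ₀ - t * + suc k) * det W)             ≡⟨ ℤ.*-comm λ₀ _ ⟩
    (λ₀ - t * + suc k) * det W * λ₀               ≡⟨ ℤ.*-assoc (λ₀ - t * + suc k) (det W) λ₀ ⟩
    (λ₀ - t * + suc k) * (det W * λ₀)             ≡⟨ cong ((λ₀ - t * + suc k) *_) (sym detZ) ⟩
    (λ₀ - t * + suc k) * det Z                    ∎
    where
      open ≡-Reasoning
      W : Matrix (suc k)
      W = setRow Z zero ones
      detZ : det Z ≡ det W * λ₀
      detZ = trans (sym (det-cong (λ e f → ℤ.+-identityʳ (Z e f))))
        (trans (det-subConst-rowOnes (+ 0)) (trans (cong (_* det W) (ℤ.+-identityʳ λ₀)) (ℤ.*-comm λ₀ (det W))))

det-subConst : ∀ k (Z : Matrix k) (λ₀ t : ℤ) → (∀ f → sumFin (λ e → Z e f) ≡ λ₀) →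
  λ₀ * det (λ e f → Z e f - t) ≡ (λ₀ - t * + k) * det Z
det-subConst zero    Z λ₀ t _      = trans (ℤ.*-identityʳ λ₀) (sym (trans (ℤ.*-identityʳ _)
  (trans (cong (_-_ λ₀) (ℤ.*-zeroʳ t)) (ℤ.+-identityʳ λ₀))))
det-subConst (suc k) Z λ₀ t colsum = ConstantColumnSums.det-subConst Z λ₀ colsum t

-- Eliminating in [b I, -R; Rᵀ, I] in two ways, once from the top and once (after scaling by b) from the bottom.
det-sylvester : ∀ n m (R : Mat n m) (b : ℤ) →
  b ^ m * det (λ v w → b * δ v w + sumFin (λ g → R v g * R w g))
    ≡ b ^ n * det (λ e f → b * δ e f + sumFin (λ u → R u e * R u f))
det-sylvester n m R b = begin
  b ^ m * det (λ v w → b * δ v w + RRᵀ v w)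
    ≡⟨ cong (b ^ m *_) (sym eliminateTop) ⟩
  b ^ m * det (blk bI -R Rᵀ δ)
    ≡⟨ sym (det-blk-scaleBottom bI -R Rᵀ δ b) ⟩
  det (blk bI -R (λ e v → b * Rᵀ e v) (λ e f → b * δ e f))
    ≡⟨ sym (det-blk-addTopToBottom bI -R (λ e v → b * Rᵀ e v) (λ e f → b * δ e f) (λ e u → - R u e)) ⟩
  det (blk bI -R (λ e w → b * Rᵀ e w + sumFin (λ u → - R u e * bI u w)) (λ e f → b * δ e f + sumFin (λ u → - R u e * -R u f)))
    ≡⟨ det-blk-cong (λ _ _ → refl) (λ _ _ → refl) bottomLeft≡0 bottomRight≡ ⟩
  det (blk bI -R (λ _ _ → + 0) (λ e f → b * δ e f + RᵀR e f))
    ≡⟨ det-blk-upper bI -R (λ e f → b * δ e f + RᵀR e f) ⟩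
  det bI * det (λ e f → b * δ e f + RᵀR e f)
    ≡⟨ cong (_* det (λ e f → b * δ e f + RᵀR e f)) (det-scalarδ n b) ⟩
  b ^ n * det (λ e f → b * δ e f + RᵀR e f) ∎
  where
    open ≡-Reasoning
    open Blocks n m
    RRᵀ : Matrix n
    RRᵀ v w = sumFin (λ g → R v g * R w g)
    RᵀR : Matrix m
    RᵀR e f = sumFin (λ u → R u e * R u f)
    bI : Matrix n
    bI v w = b * δ v w
    -R : Mat n m
    -R v e = - R v e
    Rᵀ : Mat m n
    Rᵀ e v = R v e
    eliminateTop : det (blk bI -R Rᵀ δ) ≡ det (λ v w → b * δ v w + RRᵀ v w)
    eliminateTop = begin
      det (blk bI -R Rᵀ δ)
        ≡⟨ sym (det-blk-addBottomToTop bI -R Rᵀ δ R) ⟩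
      det (blk (λ v w → bI v w + RRᵀ v w) (λ v f → - R v f + sumFin (λ g → R v g * δ g f)) Rᵀ δ)
        ≡⟨ det-blk-cong (λ _ _ → refl) (λ v f → trans (cong (_+_ (- R v f)) (sumFin-*δ (R v) f)) (ℤ.+-inverseˡ (R v f)))
                        (λ _ _ → refl) (λ _ _ → refl) ⟩
      det (blk (λ v w → bI v w + RRᵀ v w) (λ _ _ → + 0) Rᵀ δ)
        ≡⟨ det-blk-lower (λ v w → bI v w + RRᵀ v w) Rᵀ δ ⟩
      det (λ v w → b * δ v w + RRᵀ v w) * det {m} δ
        ≡⟨ trans (cong (det (λ v w → b * δ v w + RRᵀ v w) *_) (det-δ m)) (ℤ.*-identityʳ _) ⟩
      det (λ v w → b * δ v w + RRᵀ v w) ∎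
    bottomLeft≡0 : ∀ e w → b * R w e + sumFin (λ u → - R u e * bI u w) ≡ + 0
    bottomLeft≡0 e w = begin
      b * R w e + sumFin (λ u → - R u e * (b * δ u w))
        ≡⟨ cong (_+_ (b * R w e)) (trans (sumFin-cong (λ u → sym (ℤ.*-assoc (- R u e) b (δ u w))))
                                         (sumFin-*δ (λ u → - R u e * b) w)) ⟩
      b * R w e + - R w e * b
        ≡⟨ cancel b (R w e) ⟩
      + 0 ∎
      where cancel : ∀ b x → b * x + - x * b ≡ + 0
            cancel = solve-∀
    bottomRight≡ : ∀ e f → b * δ e f + sumFin (λ u → - R u e * - R u f) ≡ b * δ e f + RᵀR e f
    bottomRight≡ e f = cong (_+_ (b * δ e f)) (sumFin-cong (λ u → negSquare (R u e) (R u f)))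
      where negSquare : ∀ x y → - x * - y ≡ x * y
            negSquare = solve-∀

-- Scaling the lower rows by a and subtracting the upper rows is a Schur complement of a I.
det-blk-schur : ∀ n m (a : ℤ) (B : Matrix m) →
  a ^ m * det (Blocks.blk n m (λ v w → a * δ v w) (λ _ _ → - + 1) (λ _ _ → - + 1) (λ e f → B e f - + 1))
    ≡ a ^ n * det (λ e f → a * B e f - (a + + n))
det-blk-schur n m a B = begin
  a ^ m * det (blk aI -J -Jᵀ (λ e f → B e f - + 1))
    ≡⟨ sym (det-blk-scaleBottom aI -J -Jᵀ (λ e f → B e f - + 1) a) ⟩
  det (blk aI -J (λ e v → a * - + 1) (λ e f → a * (B e f - + 1)))
    ≡⟨ sym (det-blk-addTopToBottom aI -J (λ e v → a * - + 1) (λ e f → a * (B e f - + 1)) (λ _ _ → + 1)) ⟩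
  det (blk aI -J (λ e w → a * - + 1 + sumFin (λ u → + 1 * aI u w)) (λ e f → a * (B e f - + 1) + sumFin (λ u → + 1 * -J u f)))
    ≡⟨ det-blk-cong (λ _ _ → refl) (λ _ _ → refl) bottomLeft≡0 bottomRight≡ ⟩
  det (blk aI -J (λ _ _ → + 0) (λ e f → a * B e f - (a + + n)))
    ≡⟨ det-blk-upper aI -J (λ e f → a * B e f - (a + + n)) ⟩
  det aI * det (λ e f → a * B e f - (a + + n))
    ≡⟨ cong (_* det (λ e f → a * B e f - (a + + n))) (det-scalarδ n a) ⟩
  a ^ n * det (λ e f → a * B e f - (a + + n)) ∎
  where
    open ≡-Reasoning
    open Blocks n m
    aI : Matrix n
    aI v w = a * δ v w
    -J : Mat n m
    -J _ _ = - + 1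
    -Jᵀ : Mat m n
    -Jᵀ _ _ = - + 1
    bottomLeft≡0 : ∀ e w → a * - + 1 + sumFin (λ u → + 1 * aI u w) ≡ + 0
    bottomLeft≡0 e w = trans (cong (_+_ (a * - + 1)) (trans (sumFin-cong (λ u → ℤ.*-identityˡ (a * δ u w)))
                                                                 (sumFin-*δ (λ _ → a) w)))
                                   (cancel a)
      where cancel : ∀ a → a * - + 1 + a ≡ + 0
            cancel = solve-∀
    bottomRight≡ : ∀ e f → a * (B e f - + 1) + sumFin {n} (λ u → + 1 * - + 1) ≡ a * B e f - (a + + n)
    bottomRight≡ e f = trans (cong (_+_ (a * (B e f - + 1))) (sumFin-const n (+ 1 * - + 1))) (expand a (B e f) (+ n))
      where expand : ∀ a x n → a * (x - + 1) + n * (+ 1 * - + 1) ≡ a * x - (a + n)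
            expand = solve-∀

module IncidenceMatrix {n m r : ℕ} (R : Mat n m)
  (rowsum : ∀ v → sumFin (R v) ≡ + r) (colsum : ∀ e → sumFin (λ v → R v e) ≡ + 2) where

  K : Matrix m
  K e f = sumFin (λ u → R u e * R u f)

  L : Matrix n
  L v w = sumFin (λ g → R v g * R w g)

  -- For the incidence matrix of G this is xI − Q(G^{0-1}), with a = x − m and b = x − m − n + 2r − 2.
  charMatrix : ℤ → ℤ → Matrix (n N.+ m)
  charMatrix a b = Blocks.blk n m (λ v w → a * δ v w) (λ _ _ → - + 1) (λ _ _ → - + 1) (λ e f → b * δ e f + K e f - + 1)

  K-sym : ∀ e f → K e f ≡ K f e
  K-sym e f = sumFin-cong (λ u → ℤ.*-comm (R u e) (R u f))

  sumFin-K : ∀ f → sumFin (λ e → K e f) ≡ + r * + 2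
  sumFin-K f = begin
    sumFin (λ e → sumFin (λ u → R u e * R u f)) ≡⟨ sumFin-comm (λ e u → R u e * R u f) ⟩
    sumFin (λ u → sumFin (λ e → R u e * R u f)) ≡⟨ sumFin-cong (λ u → trans (sumFin-*ʳ (R u f) (R u))
                                                                           (cong (_* R u f) (rowsum u))) ⟩
    sumFin (λ u → + r * R u f)                  ≡⟨ sumFin-*ˡ (+ r) (λ u → R u f) ⟩
    + r * sumFin (λ u → R u f)                  ≡⟨ cong (+ r *_) (colsum f) ⟩
    + r * + 2                                   ∎
    where open ≡-Reasoning

  sumFin-scaledB : ∀ a b f → sumFin (λ e → a * (b * δ e f + K e f)) ≡ a * (b + + r * + 2)
  sumFin-scaledB a b f = trans (sumFin-*ˡ a (λ e → b * δ e f + K e f))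
    (cong (a *_) (trans (sumFin-+ (λ e → b * δ e f) (λ e → K e f)) (cong₂ _+_ (sumFin-*δ (λ _ → b) f) (sumFin-K f))))

  det-charMatrix-identity-a≢0 : ∀ n′ → n ≡ suc n′ → ∀ a b → ¬ a ≡ + 0 →
    det (charMatrix a b) * (b + + r * + 2) * b ^ n
      ≡ (a * (b - + m + + r * + 2) - + m * + n) * b ^ m * a ^ n′ * det (λ v w → b * δ v w + L v w)
  det-charMatrix-identity-a≢0 n′ refl a b a≢0 = ℤ.*-cancelˡ-≡ (a ^ suc m) _ _
    {{≢-nonZero (λ aᵐ⁺¹≡0 → a≢0 (ℤ.i^n≡0⇒i≡0 a (suc m) aᵐ⁺¹≡0))}} (begin
    a * A * (D0 * c * P)                       ≡⟨ regroup₁ a A D0 c P ⟩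
    a * c * P * (A * D0)                       ≡⟨ cong (a * c * P *_) (det-blk-schur (suc n′) m a B) ⟩
    a * c * P * (a * A′ * DY)                  ≡⟨ regroup₂ a c P A′ DY ⟩
    a * A′ * P * (λ₀ * DY)
      ≡⟨ cong (a * A′ * P *_) (det-subConst m (λ e f → a * B e f) λ₀ (a + + suc n′) (sumFin-scaledB a b)) ⟩
    a * A′ * P * ((λ₀ - (a + + suc n′) * + m) * det (λ e f → a * B e f))
                                               ≡⟨ cong (λ d → a * A′ * P * ((λ₀ - (a + + suc n′) * + m) * d)) (det-scale a B) ⟩
    a * A′ * P * ((λ₀ - (a + + suc n′) * + m) * (A * DB))
                                               ≡⟨ regroup₃ a A′ P (λ₀ - (a + + suc n′) * + m) A DB ⟩
    a * A′ * (λ₀ - (a + + suc n′) * + m) * A * (P * DB)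
      ≡⟨ cong (a * A′ * (λ₀ - (a + + suc n′) * + m) * A *_) (sym (det-sylvester (suc n′) m R b)) ⟩
    a * A′ * (λ₀ - (a + + suc n′) * + m) * A * (Q * DL)
                                               ≡⟨ regroup₄ a A′ b (+ r) A Q DL (+ m) (+ suc n′) ⟩
    a * A * ((a * (b - + m + + r * + 2) - + m * + suc n′) * Q * A′ * DL) ∎)
    where
      open ≡-Reasoning
      B : Matrix m
      B e f = b * δ e f + K e f
      A A′ P Q c λ₀ D0 DY DB DL : ℤ
      A = a ^ m
      A′ = a ^ n′
      P = b ^ suc n′
      Q = b ^ m
      c = b + + r * + 2
      λ₀ = a * c
      D0 = det (charMatrix a b)
      DY = det (λ e f → a * B e f - (a + + suc n′))
      DB = det B
      DL = det (λ v w → b * δ v w + L v w)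
      regroup₁ : ∀ a A D0 c P → a * A * (D0 * c * P) ≡ a * c * P * (A * D0)
      regroup₁ = solve-∀
      regroup₂ : ∀ a c P A′ DY → a * c * P * (a * A′ * DY) ≡ a * A′ * P * (a * c * DY)
      regroup₂ = solve-∀
      regroup₃ : ∀ a A′ P x A DB → a * A′ * P * (x * (A * DB)) ≡ a * A′ * x * A * (P * DB)
      regroup₃ = solve-∀
      regroup₄ : ∀ a A′ b r A Q DL m n → a * A′ * (a * (b + r * + 2) - (a + n) * m) * A * (Q * DL)
                                         ≡ a * A * ((a * (b - m + r * + 2) - m * n) * Q * A′ * DL)
      regroup₄ = solve-∀

  det-charMatrix-a≡0 : ∀ n′ → n ≡ suc n′ → (n′ ≡ 0 → m ≡ 0) → ∀ b → det (charMatrix (+ 0) b) ≡ + 0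
  det-charMatrix-a≡0 (suc n″) refl _ b = det-equalRows (charMatrix (+ 0) b) zero (suc zero) (λ ()) (λ _ → refl)
  det-charMatrix-a≡0 zero refl single b with single refl
  ... | refl = det-zeroRow (charMatrix (+ 0) b) zero (λ { zero → refl })

  det-charMatrix-identity : ∀ n′ → n ≡ suc n′ → (n′ ≡ 0 → m ≡ 0) → ∀ a b →
    det (charMatrix a b) * (b + + r * + 2) * b ^ n
      ≡ (a * (b - + m + + r * + 2) - + m * + n) * b ^ m * a ^ n′ * det (λ v w → b * δ v w + L v w)
  det-charMatrix-identity n′ n≡1+n′ single a b with a ℤ.≟ + 0
  ... | no a≢0   = det-charMatrix-identity-a≢0 n′ n≡1+n′ a b a≢0
  ... | yes refl = trans (cong (λ d → d * (b + + r * + 2) * b ^ n) (det-charMatrix-a≡0 n′ n≡1+n′ single b))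
                         (sym (rhs≡0 n′ n≡1+n′ single))
    where
      rhs≡0 : ∀ n′ → n ≡ suc n′ → (n′ ≡ 0 → m ≡ 0) →
        (+ 0 * (b - + m + + r * + 2) - + m * + n) * b ^ m * (+ 0) ^ n′ * det (λ v w → b * δ v w + L v w) ≡ + 0
      rhs≡0 (suc n″) refl _ =
        cong (_* det (λ v w → b * δ v w + L v w)) (ℤ.*-zeroʳ ((+ 0 * (b - + m + + r * + 2) - + m * + n) * b ^ m))
      rhs≡0 zero     refl single with single refl
      ... | refl = refl

ind-∧ : ∀ x y → ind (x ∧ y) ≡ ind x * ind y
ind-∧ true  y = sym (ℤ.*-identityˡ (ind y))
ind-∧ false y = refl

ind-nor : ∀ x y → (x ≡ true → y ≡ false) → ind (not x ∧ not y) ≡ + 1 - ind x - ind y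
ind-nor true  y exclusive rewrite exclusive refl = refl
ind-nor false true  _ = refl
ind-nor false false _ = refl

ind-idem : ∀ x → ind x * ind x ≡ ind x
ind-idem true  = refl
ind-idem false = refl

ind-∨-disjoint : ∀ x y → (x ≡ true → y ≡ true → ⊥) → ind (x ∨ y) ≡ ind x + ind y
ind-∨-disjoint true  true  disjoint = ⊥-elim (disjoint refl refl)
ind-∨-disjoint true  false _        = refl
ind-∨-disjoint false y     _        = sym (ℤ.+-identityˡ (ind y))

∧≡true⇒ : ∀ {x y} → x ∧ y ≡ true → x ≡ true × y ≡ true
∧≡true⇒ {true} {true} _ = refl , refl

anyFin-false : ∀ {k} (p : Fin k → Bool) → (∀ i → p i ≡ false) → anyFin p ≡ false
anyFin-false {zero}  p p≗false = refl
anyFin-false {suc k} p p≗false rewrite p≗false zero = anyFin-false (λ i → p (suc i)) (λ i → p≗false (suc i))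

ind-anyFin : ∀ {k} (p : Fin k → Bool) → (∀ i j → p i ≡ true → p j ≡ true → i ≡ j) →
  ind (anyFin p) ≡ sumFin (λ i → ind (p i))
ind-anyFin {zero}  p unique = refl
ind-anyFin {suc k} p unique with p zero in p₀
... | true  = sym (cong (_+_ (+ 1)) (sumFin-zero _ rest-false))
  where rest-false : ∀ i → ind (p (suc i)) ≡ + 0
        rest-false i with p (suc i) in pᵢ
        ... | true  = ⊥-elim (0≢suc (unique zero (suc i) p₀ pᵢ))
          where 0≢suc : ∀ {k} {i : Fin k} → ¬ zero ≡ suc i
                0≢suc ()
        ... | false = refl
... | false = trans (ind-anyFin (λ i → p (suc i)) (λ i j pᵢ pⱼ → fsuc-injective (unique (suc i) (suc j) pᵢ pⱼ)))
                    (sym (ℤ.+-identityˡ _))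

signlessLaplacian-≡ : ∀ {k} (adj : Fin k → Fin k → Bool) → (∀ i → adj i i ≡ false) →
  ∀ i j → signlessLaplacian adj i j ≡ + deg adj i * δ i j + ind (adj i j)
signlessLaplacian-≡ adj irreflexive i j with i ≟ j
... | yes refl rewrite irreflexive i = sym (trans (ℤ.+-identityʳ _) (ℤ.*-identityʳ _))
... | no _ = sym (trans (cong (_+ ind (adj i j)) (ℤ.*-zeroʳ (+ deg adj i))) (ℤ.+-identityˡ _))

charPolyAt-≡ : ∀ {k} (Q : Matrix k) (x : ℤ) i j → charPolyAt Q x i j ≡ x * δ i j - Q i j
charPolyAt-≡ Q x i j with eqᵇ i j
... | true  = cong (_- Q i j) (sym (ℤ.*-identityʳ x))
... | false = cong (_- Q i j) (sym (ℤ.*-zeroʳ x))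

module GraphIncidence {n m : ℕ} (G : SimpleGraph n m) where

  end₁ end₂ : Fin m → Fin n
  end₁ e = proj₁ (ends G e)
  end₂ e = proj₂ (ends G e)

  end₁≢end₂ : ∀ e → ¬ end₁ e ≡ end₂ e
  end₁≢end₂ e eq = N.<-irrefl (cong toℕ eq) (ordered G e)

  incidence : Mat n m
  incidence v e = ind (incident G v e)

  incident⇒end : ∀ v e → incident G v e ≡ true → v ≡ end₁ e ⊎ v ≡ end₂ e
  incident⇒end v e v∈e with v ≟ end₁ e | v ≟ end₂ e
  ... | yes v≡end₁ | _          = inj₁ v≡end₁
  ... | no _       | yes v≡end₂ = inj₂ v≡end₂
  incident⇒end v e () | no _ | no _

  incident-end₁ : ∀ e → incident G (end₁ e) e ≡ true
  incident-end₁ e rewrite eqᵇ-refl (end₁ e) = refl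

  incident-end₂ : ∀ e → incident G (end₂ e) e ≡ true
  incident-end₂ e rewrite eqᵇ-refl (end₂ e) with eqᵇ (end₂ e) (end₁ e)
  ... | true  = refl
  ... | false = refl

  sumFin-incidence : ∀ e (g : Fin n → ℤ) → sumFin (λ v → incidence v e * g v) ≡ g (end₁ e) + g (end₂ e)
  sumFin-incidence e g = trans (sumFin-cong split) (trans (sumFin-+ (select (end₁ e)) (select (end₂ e)))
    (cong₂ _+_ (sumFin-select (end₁ e) g) (sumFin-select (end₂ e) g)))
    where
      select : Fin n → Fin n → ℤ
      select u v = if eqᵇ v u then g v else + 0
      split : ∀ v → incidence v e * g v ≡ select (end₁ e) v + select (end₂ e) v
      split v with end₁ e ≟ v | end₂ e ≟ v
      ... | yes refl | yes end₂≡v = ⊥-elim (end₁≢end₂ e (sym end₂≡v))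
      ... | yes refl | no end₂≢v rewrite eqᵇ-refl (end₁ e) | eqᵇ-≢ (λ eq → end₂≢v (sym eq)) =
            trans (ℤ.*-identityˡ (g v)) (sym (ℤ.+-identityʳ (g v)))
      ... | no end₁≢v | yes refl rewrite eqᵇ-refl (end₂ e) | eqᵇ-≢ (λ eq → end₁≢v (sym eq)) =
            trans (ℤ.*-identityˡ (g v)) (sym (ℤ.+-identityˡ (g v)))
      ... | no end₁≢v | no end₂≢v rewrite eqᵇ-≢ (λ eq → end₁≢v (sym eq)) | eqᵇ-≢ (λ eq → end₂≢v (sym eq)) = refl

  incidence-colsum : ∀ e → sumFin (λ v → incidence v e) ≡ + 2
  incidence-colsum e = trans (sumFin-cong (λ v → sym (ℤ.*-identityʳ (incidence v e)))) (sumFin-incidence e (λ _ → + 1))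

  incidence-rowsum : ∀ {r} → IsRegular G r → ∀ v → sumFin (incidence v) ≡ + r
  incidence-rowsum regular v = trans (sumFin-ind (incident G v)) (cong +_ (regular v))

  edge-determinedByEnds : ∀ e f → incident G (end₁ e) f ≡ true → incident G (end₂ e) f ≡ true → e ≡ f
  edge-determinedByEnds e f e₁∈f e₂∈f with incident⇒end (end₁ e) f e₁∈f | incident⇒end (end₂ e) f e₂∈f
  ... | inj₁ p | inj₁ q = ⊥-elim (end₁≢end₂ e (trans p (sym q)))
  ... | inj₂ p | inj₂ q = ⊥-elim (end₁≢end₂ e (trans p (sym q)))
  ... | inj₁ p | inj₂ q = inj G e f (cong₂ _,_ p q)
  ... | inj₂ p | inj₁ q = ⊥-elim (N.<-asym (ordered G e)
          (subst₂ (λ a b → toℕ a N.< toℕ b) (sym q) (sym p) (ordered G f)))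

  commonEdge-unique : ∀ {v w} → ¬ v ≡ w → ∀ e f →
    incident G v e ≡ true → incident G w e ≡ true → incident G v f ≡ true → incident G w f ≡ true → e ≡ f
  commonEdge-unique v≢w e f v∈e w∈e v∈f w∈f with incident⇒end _ e v∈e | incident⇒end _ e w∈e
  ... | inj₁ p | inj₁ q = ⊥-elim (v≢w (trans p (sym q)))
  ... | inj₂ p | inj₂ q = ⊥-elim (v≢w (trans p (sym q)))
  ... | inj₁ p | inj₂ q = edge-determinedByEnds e f (subst (λ z → incident G z f ≡ true) p v∈f)
                                                     (subst (λ z → incident G z f ≡ true) q w∈f)
  ... | inj₂ p | inj₁ q = edge-determinedByEnds e f (subst (λ z → incident G z f ≡ true) q w∈f)
                                                     (subst (λ z → incident G z f ≡ true) p v∈f)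

  module Regular {r : ℕ} (regular : IsRegular G r) where

    open IncidenceMatrix incidence (incidence-rowsum regular) incidence-colsum public

    K-diagonal : ∀ e → K e e ≡ + 2
    K-diagonal e = trans (sumFin-incidence e (λ v → incidence v e))
      (cong₂ _+_ (cong ind (incident-end₁ e)) (cong ind (incident-end₂ e)))

    K≡2δ+adjLine : ∀ e f → K e f ≡ + 2 * δ e f + ind (adjLine G e f)
    K≡2δ+adjLine e f with e ≟ f
    ... | yes refl = K-diagonal e
    ... | no e≢f = trans (sumFin-incidence e (λ v → incidence v f))
      (sym (trans (ℤ.+-identityˡ _) (ind-∨-disjoint _ _ (λ e₁∈f e₂∈f → e≢f (edge-determinedByEnds e f e₁∈f e₂∈f)))))

    L≡rδ+adjG : ∀ v w → L v w ≡ + r * δ v w + ind (adjG G v w)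
    L≡rδ+adjG v w with v ≟ w
    ... | yes refl = trans (sumFin-cong (λ g → ind-idem (incident G v g)))
      (trans (incidence-rowsum regular v) (sym (trans
        (cong (λ b → + r * + 1 + ind b) (anyFin-false _ (λ e → trans (cong (incident G v e ∧_) (∧-zeroʳ _)) (∧-zeroʳ _))))
        (trans (ℤ.+-identityʳ _) (ℤ.*-identityʳ (+ r))))))
    ... | no v≢w = sym (begin
      + r * + 0 + ind (anyFin common)       ≡⟨ trans (cong (_+ ind (anyFin common)) (ℤ.*-zeroʳ (+ r))) (ℤ.+-identityˡ _) ⟩
      ind (anyFin common)                   ≡⟨ ind-anyFin common unique ⟩
      sumFin (λ e → ind (common e))         ≡⟨ sumFin-cong (λ e → trans (ind-∧ (incident G v e) _)
                                                 (cong (λ b → incidence v e * ind b) (∧-identityʳ (incident G w e)))) ⟩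
      L v w                                 ∎)
      where
        open ≡-Reasoning
        common : Fin m → Bool
        common e = incident G v e ∧ incident G w e ∧ true
        ends-incident : ∀ e → common e ≡ true → incident G v e ≡ true × incident G w e ≡ true
        ends-incident e ce with ∧≡true⇒ {incident G v e} ce
        ... | v∈e , rest = v∈e , proj₁ (∧≡true⇒ {incident G w e} rest)
        unique : ∀ e f → common e ≡ true → common f ≡ true → e ≡ f
        unique e f ce cf = commonEdge-unique v≢w e f
          (proj₁ (ends-incident e ce)) (proj₂ (ends-incident e ce)) (proj₁ (ends-incident f cf)) (proj₂ (ends-incident f cf))

    sumFin-L : ∀ v → sumFin (L v) ≡ + r * + 2
    sumFin-L v = begin
      sumFin (λ w → sumFin (λ g → incidence v g * incidence w g))
        ≡⟨ sumFin-comm (λ w g → incidence v g * incidence w g) ⟩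
      sumFin (λ g → sumFin (λ w → incidence v g * incidence w g))
        ≡⟨ sumFin-cong (λ g → trans (sumFin-*ˡ (incidence v g) (λ w → incidence w g))
                                    (cong (incidence v g *_) (incidence-colsum g))) ⟩
      sumFin (λ g → incidence v g * + 2)
        ≡⟨ sumFin-*ʳ (+ 2) (incidence v) ⟩
      sumFin (incidence v) * + 2
        ≡⟨ cong (_* + 2) (incidence-rowsum regular v) ⟩
      + r * + 2 ∎
      where open ≡-Reasoning

    adjG-irreflexive : ∀ v → adjG G v v ≡ false
    adjG-irreflexive v rewrite eqᵇ-refl v =
      anyFin-false _ (λ e → trans (cong (incident G v e ∧_) (∧-zeroʳ _)) (∧-zeroʳ _))

    -- Summing L≡rδ+adjG over w: 2r = r + deg v.
    deg-adjG : ∀ v → + deg (adjG G) v ≡ + r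
    deg-adjG v = ∙-cancelˡ (+ r) (+ deg (adjG G) v) (+ r) (begin
      + r + + deg (adjG G) v
        ≡⟨ cong₂ _+_ (sym (trans (sumFin-*ˡ (+ r) (δ v)) (trans (cong (+ r *_) (sumFin-δ v)) (ℤ.*-identityʳ (+ r)))))
                     (sym (sumFin-ind (adjG G v))) ⟩
      sumFin (λ w → + r * δ v w) + sumFin (λ w → ind (adjG G v w))
        ≡⟨ sym (sumFin-+ (λ w → + r * δ v w) (λ w → ind (adjG G v w))) ⟩
      sumFin (λ w → + r * δ v w + ind (adjG G v w))
        ≡⟨ sumFin-cong (λ w → sym (L≡rδ+adjG v w)) ⟩
      sumFin (L v)
        ≡⟨ sumFin-L v ⟩
      + r * + 2
        ≡⟨ double (+ r) ⟩
      + r + + r ∎)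
      where open ≡-Reasoning
            double : ∀ x → x * + 2 ≡ x + x
            double = solve-∀

    signlessLaplacian-adjG : ∀ v w → signlessLaplacian (adjG G) v w ≡ L v w
    signlessLaplacian-adjG v w = trans (signlessLaplacian-≡ (adjG G) adjG-irreflexive v w)
      (trans (cong (λ d → d * δ v w + ind (adjG G v w)) (deg-adjG v)) (sym (L≡rδ+adjG v w)))

    signlessCharPoly-adjG : ∀ b → (- + 1) ^ n * signlessCharPoly (adjG G) (- b) ≡ det (λ v w → b * δ v w + L v w)
    signlessCharPoly-adjG b = trans (sym (det-scale (- + 1) (charPolyAt (signlessLaplacian (adjG G)) (- b))))
      (det-cong (λ v w → trans (cong (- + 1 *_) (trans (charPolyAt-≡ (signlessLaplacian (adjG G)) (- b) v w)
                                                         (cong (_-_ (- b * δ v w)) (signlessLaplacian-adjG v w))))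
                               (negate b (δ v w) (L v w))))
      where negate : ∀ b d l → - + 1 * (- b * d - l) ≡ b * d + l
            negate = solve-∀

    open Blocks n m

    adj0m1-↑ˡ-↑ˡ : ∀ v w → adj0m1 G (v ↑ˡ m) (w ↑ˡ m) ≡ false
    adj0m1-↑ˡ-↑ˡ v w rewrite splitAt-↑ˡ n v m | splitAt-↑ˡ n w m = refl

    adj0m1-↑ˡ-↑ʳ : ∀ v f → adj0m1 G (v ↑ˡ m) (n ↑ʳ f) ≡ true
    adj0m1-↑ˡ-↑ʳ v f rewrite splitAt-↑ˡ n v m | splitAt-↑ʳ n m f = refl

    adj0m1-↑ʳ-↑ˡ : ∀ e w → adj0m1 G (n ↑ʳ e) (w ↑ˡ m) ≡ true
    adj0m1-↑ʳ-↑ˡ e w rewrite splitAt-↑ʳ n m e | splitAt-↑ˡ n w m = refl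

    adj0m1-↑ʳ-↑ʳ : ∀ e f → adj0m1 G (n ↑ʳ e) (n ↑ʳ f) ≡ not (eqᵇ e f) ∧ not (adjLine G e f)
    adj0m1-↑ʳ-↑ʳ e f rewrite splitAt-↑ʳ n m e | splitAt-↑ʳ n m f = refl

    adj0m1-irreflexive : ∀ i → adj0m1 G i i ≡ false
    adj0m1-irreflexive = ↑-elim _ (λ v → adj0m1-↑ˡ-↑ˡ v v)
      (λ e → trans (adj0m1-↑ʳ-↑ʳ e e) (cong (λ b → not b ∧ not (adjLine G e e)) (eqᵇ-refl e)))

    ind-adj0m1-edges : ∀ e f → ind (adj0m1 G (n ↑ʳ e) (n ↑ʳ f)) ≡ + 1 + δ e f - K e f
    ind-adj0m1-edges e f = begin
      ind (adj0m1 G (n ↑ʳ e) (n ↑ʳ f))               ≡⟨ cong ind (adj0m1-↑ʳ-↑ʳ e f) ⟩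
      ind (not (eqᵇ e f) ∧ not (adjLine G e f))      ≡⟨ ind-nor (eqᵇ e f) (adjLine G e f)
                                                          (cong (λ b → not b ∧ (incident G (end₁ e) f ∨ incident G (end₂ e) f))) ⟩
      + 1 - δ e f - ind (adjLine G e f)              ≡⟨ rearrange (δ e f) (ind (adjLine G e f)) ⟩
      + 1 + δ e f - (+ 2 * δ e f + ind (adjLine G e f)) ≡⟨ cong (λ k → + 1 + δ e f - k) (sym (K≡2δ+adjLine e f)) ⟩
      + 1 + δ e f - K e f                            ∎
      where open ≡-Reasoning
            rearrange : ∀ d a → + 1 - d - a ≡ + 1 + d - (+ 2 * d + a)
            rearrange = solve-∀

    deg-adj0m1-vertex : ∀ v → + deg (adj0m1 G) (v ↑ˡ m) ≡ + m
    deg-adj0m1-vertex v = begin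
      + deg (adj0m1 G) (v ↑ˡ m)
        ≡⟨ sym (sumFin-ind (adj0m1 G (v ↑ˡ m))) ⟩
      sumFin (λ j → ind (adj0m1 G (v ↑ˡ m) j))
        ≡⟨ sumFin-splitAt n m (λ j → ind (adj0m1 G (v ↑ˡ m) j)) ⟩
      sumFin (λ w → ind (adj0m1 G (v ↑ˡ m) (w ↑ˡ m))) + sumFin (λ f → ind (adj0m1 G (v ↑ˡ m) (n ↑ʳ f)))
        ≡⟨ cong₂ _+_ (sumFin-zero _ (λ w → cong ind (adj0m1-↑ˡ-↑ˡ v w)))
                     (trans (sumFin-cong (λ f → cong ind (adj0m1-↑ˡ-↑ʳ v f))) (sumFin-const m (+ 1))) ⟩
      + 0 + + m * + 1
        ≡⟨ trans (ℤ.+-identityˡ _) (ℤ.*-identityʳ (+ m)) ⟩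
      + m ∎
      where open ≡-Reasoning

    deg-adj0m1-edge : ∀ e → + deg (adj0m1 G) (n ↑ʳ e) ≡ + n + + m + + 1 - + r * + 2
    deg-adj0m1-edge e = begin
      + deg (adj0m1 G) (n ↑ʳ e)
        ≡⟨ sym (sumFin-ind (adj0m1 G (n ↑ʳ e))) ⟩
      sumFin (λ j → ind (adj0m1 G (n ↑ʳ e) j))
        ≡⟨ sumFin-splitAt n m (λ j → ind (adj0m1 G (n ↑ʳ e) j)) ⟩
      sumFin (λ w → ind (adj0m1 G (n ↑ʳ e) (w ↑ˡ m))) + sumFin (λ f → ind (adj0m1 G (n ↑ʳ e) (n ↑ʳ f)))
        ≡⟨ cong₂ _+_ (trans (sumFin-cong (λ w → cong ind (adj0m1-↑ʳ-↑ˡ e w))) (sumFin-const n (+ 1)))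
                     (sumFin-cong (ind-adj0m1-edges e)) ⟩
      + n * + 1 + sumFin (λ f → + 1 + δ e f + - K e f)
        ≡⟨ cong (_+_ (+ n * + 1)) (trans (sumFin-+ (λ f → + 1 + δ e f) (λ f → - K e f))
             (cong₂ _+_ (trans (sumFin-+ (λ _ → + 1) (δ e)) (cong₂ _+_ (sumFin-const m (+ 1)) (sumFin-δ e)))
                        (trans (sumFin-neg (K e)) (cong -_ (trans (sumFin-cong (K-sym e)) (sumFin-K e)))))) ⟩
      + n * + 1 + (+ m * + 1 + + 1 + - (+ r * + 2))
        ≡⟨ rearrange (+ n) (+ m) (+ r) ⟩
      + n + + m + + 1 - + r * + 2 ∎
      where open ≡-Reasoning
            rearrange : ∀ n m r → n * + 1 + (m * + 1 + + 1 + - (r * + 2)) ≡ n + m + + 1 - r * + 2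
            rearrange = solve-∀

    charPolyAt-adj0m1 : ∀ x i j →
      charPolyAt (signlessLaplacian (adj0m1 G)) x i j ≡ charMatrix (x - + m) (x - + m - + n + + r * + 2 - + 2) i j
    charPolyAt-adj0m1 x = ≗-blk _
      (λ v w → trans (entry (v ↑ˡ m) (w ↑ˡ m)) (trans
        (cong₃ (λ d g a → x * d - (g * d + a)) (δ-↑ˡ-↑ˡ v w) (deg-adj0m1-vertex v) (cong ind (adj0m1-↑ˡ-↑ˡ v w)))
        (topLeft≡ x (+ m) (δ v w))))
      (λ v f → trans (entry (v ↑ˡ m) (n ↑ʳ f)) (trans
        (cong₃ (λ d g a → x * d - (g * d + a)) (δ-↑ˡ-↑ʳ v f) (deg-adj0m1-vertex v) (cong ind (adj0m1-↑ˡ-↑ʳ v f)))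
        (offDiagonal≡ x (+ m))))
      (λ e w → trans (entry (n ↑ʳ e) (w ↑ˡ m)) (trans
        (cong₃ (λ d g a → x * d - (g * d + a)) (δ-↑ʳ-↑ˡ e w) (deg-adj0m1-edge e) (cong ind (adj0m1-↑ʳ-↑ˡ e w)))
        (offDiagonal≡ x (+ n + + m + + 1 - + r * + 2))))
      (λ e f → trans (entry (n ↑ʳ e) (n ↑ʳ f)) (trans
        (cong₃ (λ d g a → x * d - (g * d + a)) (δ-↑ʳ-↑ʳ e f) (deg-adj0m1-edge e) (ind-adj0m1-edges e f))
        (bottomRight≡ x (+ n) (+ m) (+ r) (δ e f) (K e f))))
      where
        entry : ∀ i j → charPolyAt (signlessLaplacian (adj0m1 G)) x i j
                          ≡ x * δ i j - (+ deg (adj0m1 G) i * δ i j + ind (adj0m1 G i j))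
        entry i j = trans (charPolyAt-≡ (signlessLaplacian (adj0m1 G)) x i j)
          (cong (_-_ (x * δ i j)) (signlessLaplacian-≡ (adj0m1 G) adj0m1-irreflexive i j))
        topLeft≡ : ∀ x m d → x * d - (m * d + + 0) ≡ (x - m) * d
        topLeft≡ = solve-∀
        offDiagonal≡ : ∀ x g → x * + 0 - (g * + 0 + + 1) ≡ - + 1
        offDiagonal≡ = solve-∀
        bottomRight≡ : ∀ x n m r d k → x * d - ((n + m + + 1 - r * + 2) * d + (+ 1 + d - k))
                                         ≡ (x - m - n + r * + 2 - + 2) * d + k - + 1
        bottomRight≡ = solve-∀

noEdges-onOneVertex : ∀ {m} → SimpleGraph 1 m → m ≡ 0
noEdges-onOneVertex {zero}  G = refl
noEdges-onOneVertex {suc m} G with ends G zero | ordered G zero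
... | zero , zero | ()

pos-2*≡ : ∀ r → + (2 N.* r) ≡ + r * + 2
pos-2*≡ r = trans (ℤ.pos-* 2 r) (ℤ.*-comm (+ 2) (+ r))

shiftedDegree≡ : ∀ (x : ℤ) m n r → x - + m - + n - + 2 + + (4 N.* r) ≡ (x - + m - + n + + r * + 2 - + 2) + + r * + 2
shiftedDegree≡ x m n r = trans (cong (_+_ (x - + m - + n - + 2)) (ℤ.pos-* 4 r)) (ring x (+ m) (+ n) (+ r))
  where ring : ∀ x m n r → x - m - n - + 2 + + 4 * r ≡ x - m - n + r * + 2 - + 2 + r * + 2
        ring = solve-∀

quadraticFactor≡ : ∀ (x : ℤ) m n r → (x - + m) * (x - + (2 N.* m) - + n + + (4 N.* r) - + 2) - + (m N.* n)
  ≡ (x - + m) * ((x - + m - + n + + r * + 2 - + 2) - + m + + r * + 2) - + m * + n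
quadraticFactor≡ x m n r = trans
  (cong₃ (λ p q s → (x - + m) * (x - p - + n + q - + 2) - s) (ℤ.pos-* 2 m) (ℤ.pos-* 4 r) (ℤ.pos-* m n))
  (ring x (+ m) (+ n) (+ r))
  where ring : ∀ x m n r → (x - m) * (x - + 2 * m - n + + 4 * r - + 2) - m * n
                             ≡ (x - m) * ((x - m - n + r * + 2 - + 2) - m + r * + 2) - m * n
        ring = solve-∀

reflectedArgument≡ : ∀ (x : ℤ) m n r → + m + + n + + 2 - + (2 N.* r) - x ≡ - (x - + m - + n + + r * + 2 - + 2)
reflectedArgument≡ x m n r = trans (cong (λ t → + m + + n + + 2 - t - x) (pos-2*≡ r)) (ring x (+ m) (+ n) (+ r))
  where ring : ∀ x m n r → m + n + + 2 - r * + 2 - x ≡ - (x - m - n + r * + 2 - + 2)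
        ring = solve-∀

mainTheorem6 : (n m r : ℕ) (G : SimpleGraph n m) → IsRegular G r → 1 ≤ n →
    (x : ℤ) →
      signlessCharPoly (adj0m1 G) x
        * (x - + m - + n - + 2 + + (4 N.* r))
        * (x - + m - + n + + (2 N.* r) - + 2) ^ n
      ≡ ((x - + m) * (x - + (2 N.* m) - + n + + (4 N.* r) - + 2) - + (m N.* n))
        * (x - + m - + n + + (2 N.* r) - + 2) ^ m
        * (x - + m) ^ (n N.∸ 1)
        * ((- + 1) ^ n * signlessCharPoly (adjG G) (+ m + + n + + 2 - + (2 N.* r) - x))
mainTheorem6 (suc n′) m r G regular (s≤s z≤n) x = begin
  signlessCharPoly (adj0m1 G) x * (x - + m - + n - + 2 + + (4 N.* r)) * (x - + m - + n + + (2 N.* r) - + 2) ^ n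
    ≡⟨ cong₃ (λ p c d → p * c * d ^ n) (det-cong (charPolyAt-adj0m1 x)) (shiftedDegree≡ x m n r) b≡ ⟩
  det (charMatrix a b) * (b + + r * + 2) * b ^ n
    ≡⟨ det-charMatrix-identity n′ refl oneVertex⇒noEdges a b ⟩
  (a * (b - + m + + r * + 2) - + m * + n) * b ^ m * a ^ n′ * det (λ v w → b * δ v w + L v w)
    ≡⟨ sym (cong₃ (λ p c d → p * c ^ m * a ^ n′ * d) (quadraticFactor≡ x m n r) b≡ charPolyG) ⟩
  ((x - + m) * (x - + (2 N.* m) - + n + + (4 N.* r) - + 2) - + (m N.* n)) * (x - + m - + n + + (2 N.* r) - + 2) ^ m
    * a ^ n′ * ((- + 1) ^ n * signlessCharPoly (adjG G) (+ m + + n + + 2 - + (2 N.* r) - x)) ∎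
  where
    open ≡-Reasoning
    open GraphIncidence G
    open Regular regular
    n : ℕ
    n = suc n′
    a b : ℤ
    a = x - + m
    b = x - + m - + n + + r * + 2 - + 2
    b≡ : x - + m - + n + + (2 N.* r) - + 2 ≡ b
    b≡ = cong (λ t → x - + m - + n + t - + 2) (pos-2*≡ r)
    charPolyG : (- + 1) ^ n * signlessCharPoly (adjG G) (+ m + + n + + 2 - + (2 N.* r) - x) ≡ det (λ v w → b * δ v w + L v w)
    charPolyG = trans (cong (λ t → (- + 1) ^ n * signlessCharPoly (adjG G) t) (reflectedArgument≡ x m n r))
                      (signlessCharPoly-adjG b)
    oneVertex⇒noEdges : n′ ≡ 0 → m ≡ 0
    oneVertex⇒noEdges n′≡0 = noEdges-onOneVertex (subst (λ k → SimpleGraph (suc k) m) n′≡0 G)
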